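{- Let $m\ge 1$, let $\mathcal{X}\subseteq\{0,1\}^m$, and let $f:\mathcal{X}\to\{0,1\}$ be a Boolean partial function such that $\mathcal{X}_0:=f^{ -1}(0)$ is nonempty. For every $\varepsilon\in[0,1]$, $$\lim_{n\to\infty}\frac{\overline{R}_{\mathrm{FP}=0,\mathrm{FN}\le\varepsilon}(\operatorname{OR}_n\circ f)}{n}=c_\varepsilon(f).$$ Moreover, for every $\varepsilon\in(0,1]$, $$\lim_{n\to\infty}\frac{R_{\mathrm{FP}=0,\mathrm{FN}\le\varepsilon}(\operatorname{OR}_n\circ f)}{n}=c_\varepsilon(f).$$
   Context: Query model. A deterministic query algorithm is a decision tree that adaptively queries single bits of the input and outputs a bit. A randomized query algorithm $A$ is a probability distribution over deterministic ones; $A_R$ is the deterministic tree for internal randomness $R$ and $|A_R(x)|$ is the number of queries it makes on input $x$. One-sided algorithms. For a Boolean function $g:\mathcal{Y}\to\{0,1\}$ with $\mathcal{Y}$ a set of bit strings of fixed length, and $\varepsilon\in[0,1]$, let $\mathfrak{A}_\varepsilon(g)$ be the class of randomized query algorithms $A$ with $\Pr[A(y)=1]=0$ for every $y\in g^{ -1}(0)$ (zero false-positive error) and $\Pr[A(y)=0]\le\varepsilon$ for every $y\in g^{ -1}(1)$ (false-negative error at most $\varepsilon$). Complexity measures. $\overline{R}_{\mathrm{FP}=0,\mathrm{FN}\le\varepsilon}(g):=\inf_{A\in\mathfrak{A}_\varepsilon(g)}\max_{y\in\mathcal{Y}}\mathbf{E}_R[|A_R(y)|]$, and $R_{\mathrm{FP}=0,\mathrm{FN}\le\varepsilon}(g):=\min_{A\in\mathfrak{A}_\varepsilon(g)}\max_{y\in\mathcal{Y},R}|A_R(y)|$.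 Single-copy quantity. $c_\varepsilon(f):=\inf_{A\in\mathfrak{A}_\varepsilon(f)}\max_{x\in\mathcal{X}_0}\mathbf{E}_R[|A_R(x)|]$ (the cost is measured only on zero-inputs). Composition. $\operatorname{OR}_n\circ f:\mathcal{X}^n\to\{0,1\}$ is $(\operatorname{OR}_n\circ f)(x_1,\dots,x_n)=\bigvee_{i=1}^n f(x_i)$; its input is the string of $nm$ bits. -}

module Defs where

open import Algebra.Bundles using (CommutativeRing)
open import Algebra.Structures using (IsCommutativeRing)
import Algebra.Definitions.RawMonoid as RawMonoidDefs
open import Data.Bool.Base using (Bool; true; false; not; _∨_; if_then_else_)
open import Data.Fin.Base using (Fin; toℕ)
open import Data.Maybe using (Maybe; just; zipWith; Is-just)
open import Data.Nat.Base as ℕ using (ℕ; zero; suc)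
open import Data.Product using (∃; ∃-syntax; _×_)
open import Data.Vec.Base using (Vec; lookup; take; drop)
open import Level using (0ℓ)
open import Relation.Binary.Core using (Rel)
open import Relation.Binary.Structures using (IsTotalOrder)
import Relation.Binary.Construct.NonStrictToStrict as ToStrict
open import Relation.Binary.PropositionalEquality using (_≡_)
open import Relation.Nullary using (¬_)
open import Relation.Unary using (Pred; _∈_)

------------------------------------------------------------------------
-- The real numbers, given by their categorical axiomatisation

IsSupremum : {A : Set} → Rel A 0ℓ → Pred A 0ℓ → A → Set
IsSupremum _≤_ S s =
  (∀ x → x ∈ S → x ≤ s) × (∀ b → (∀ x → x ∈ S → x ≤ b) → s ≤ b)

record CompleteOrderedField : Set₁ where
  infix  4 _≈_ _≤_
  infixl 6 _+_
  infixl 7 _*_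
  infix  8 -_
  infix  9 _⁻¹
  field
    Carrier           : Set
    _≈_ _≤_           : Rel Carrier 0ℓ
    _+_ _*_           : Carrier → Carrier → Carrier
    -_                : Carrier → Carrier
    0# 1#             : Carrier
    -- Only constrained away from zero.
    _⁻¹               : Carrier → Carrier
    isCommutativeRing : IsCommutativeRing _≈_ _+_ _*_ -_ 0# 1#
    0≉1               : ¬ 0# ≈ 1#
    ⁻¹-inverseʳ       : ∀ x → ¬ x ≈ 0# → x * x ⁻¹ ≈ 1#
    isTotalOrder      : IsTotalOrder _≈_ _≤_
    +-monoˡ-≤         : ∀ z {x y} → x ≤ y → x + z ≤ y + z
    *-nonneg          : ∀ {x y} → 0# ≤ x → 0# ≤ y → 0# ≤ x * y
    supremum          : (S : Pred Carrier 0ℓ) →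
                        (∃[ x ] x ∈ S) →
                        (∃[ b ] (∀ x → x ∈ S → x ≤ b)) →
                        ∃[ s ] IsSupremum _≤_ S s

  commutativeRing : CommutativeRing 0ℓ 0ℓ
  commutativeRing = record { isCommutativeRing = isCommutativeRing }

------------------------------------------------------------------------
-- Partial Boolean functions and decision trees

-- The domain of g is the set of y with g y ≢ nothing.
PartialFunction : ℕ → Set
PartialFunction N = Vec Bool N → Maybe Bool

-- The input is the concatenation of n blocks of m bits; the value is
-- defined exactly when every block lies in the domain of f.
OR_∘_ : ∀ n {m} → PartialFunction m → PartialFunction (n ℕ.* m)
OR_∘_ zero    {m} f x = just false
OR_∘_ (suc n) {m} f x = zipWith _∨_ (f (take m x)) ((OR n ∘ f) (drop m x))

data DecisionTree (N : ℕ) : Set where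
  output : Bool → DecisionTree N
  query  : Fin N → (if0 if1 : DecisionTree N) → DecisionTree N

eval : ∀ {N} → DecisionTree N → Vec Bool N → Bool
eval (output b)      y = b
eval (query i t₀ t₁) y = if lookup y i then eval t₁ y else eval t₀ y

queries : ∀ {N} → DecisionTree N → Vec Bool N → ℕ
queries (output b)      y = 0
queries (query i t₀ t₁) y =
  suc (if lookup y i then queries t₁ y else queries t₀ y)

------------------------------------------------------------------------

module QueryComplexity (ℝ : CompleteOrderedField) where

  open CompleteOrderedField ℝ public
  open CommutativeRing commutativeRing using (+-rawMonoid; _-_) public
  open RawMonoidDefs +-rawMonoid using (sum) renaming (_×_ to _·_)
  open ToStrict _≈_ _≤_ using (_<_) public

  fromℕ : ℕ → Carrier
  fromℕ n = n · 1#

  -- The quotient is meaningless for n = 0.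
  _/_ : Carrier → ℕ → Carrier
  x / n = x * fromℕ n ⁻¹

  _⟶_ : (ℕ → Carrier) → Carrier → Set
  a ⟶ l = ∀ δ → 0# < δ → ∃[ N ] (∀ n → N ℕ.≤ n →
            (l - δ < a n) × (a n < l + δ))

  SumsTo : (ℕ → Carrier) → Carrier → Set
  SumsTo a s = (λ k → sum {k} (λ i → a (toℕ i))) ⟶ s

  IsInfimum : Pred Carrier 0ℓ → Carrier → Set
  IsInfimum = IsSupremum (λ x y → y ≤ x)

  IsMinimum : Pred ℕ 0ℓ → ℕ → Set
  IsMinimum S k = k ∈ S × (∀ j → j ∈ S → k ℕ.≤ j)

  -- There are only countably many decision trees on N bits, so drawing
  -- the internal randomness R from ℕ covers every distribution on them.
  record RandomizedAlgorithm (N : ℕ) : Set where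
    field
      tree          : ℕ → DecisionTree N
      weight        : ℕ → Carrier
      weight-nonneg : ∀ R → 0# ≤ weight R
      weight-total  : SumsTo weight 1#

  open RandomizedAlgorithm public

  Expectation : ∀ {N} → RandomizedAlgorithm N →
                (DecisionTree N → Carrier) → Carrier → Set
  Expectation A h = SumsTo (λ R → weight A R * h (tree A R))

  Probability : ∀ {N} → RandomizedAlgorithm N →
                (DecisionTree N → Bool) → Carrier → Set
  Probability A E = Expectation A (λ t → if E t then 1# else 0#)

  𝔄 : ∀ {N} → Carrier → PartialFunction N → Pred (RandomizedAlgorithm N) 0ℓ
  𝔄 ε g A =
    (∀ y → g y ≡ just false → Probability A (λ t → eval t y) 0#) ×
    (∀ y → g y ≡ just true →
       ∃[ p ] (Probability A (λ t → not (eval t y)) p × p ≤ ε))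

  -- v is the maximum over y ∈ D of E_R[|A_R(y)|]; no v qualifies if one of
  -- these expectations is infinite.
  IsMaxExpectedCost : ∀ {N} → RandomizedAlgorithm N →
                      Pred (Vec Bool N) 0ℓ → Carrier → Set
  IsMaxExpectedCost A D v =
    (∀ y → y ∈ D → ∃[ e ] (IsExpectedCost y e × e ≤ v)) ×
    (∃[ y ] (y ∈ D × IsExpectedCost y v))
    where
    IsExpectedCost : Vec Bool _ → Carrier → Set
    IsExpectedCost y = Expectation A (λ t → fromℕ (queries t y))

  -- R ranges over the support of the internal randomness.
  IsMaxCost : ∀ {N} → RandomizedAlgorithm N →
              Pred (Vec Bool N) 0ℓ → ℕ → Set
  IsMaxCost A D k =
    (∀ y R → y ∈ D → 0# < weight A R → queries (tree A R) y ℕ.≤ k) ×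
    (∃[ y ] ∃[ R ] (y ∈ D × 0# < weight A R × queries (tree A R) y ≡ k))

  domain zeros : ∀ {N} → PartialFunction N → Pred (Vec Bool N) 0ℓ
  domain g y = Is-just (g y)
  zeros  g y = g y ≡ just false

  -- R̄_{FP=0,FN≤ε}(g) = v
  IsR̄ : ∀ {N} → Carrier → PartialFunction N → Carrier → Set
  IsR̄ ε g = IsInfimum (λ v → ∃[ A ] (A ∈ 𝔄 ε g × IsMaxExpectedCost A (domain g) v))

  -- R_{FP=0,FN≤ε}(g) = k
  IsR : ∀ {N} → Carrier → PartialFunction N → ℕ → Set
  IsR ε g = IsMinimum (λ k → ∃[ A ] (A ∈ 𝔄 ε g × IsMaxCost A (domain g) k))

  -- c_ε(f) = v
  IsSingleCopyCost : ∀ {N} → Carrier → PartialFunction N → Carrier → Set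
  IsSingleCopyCost ε f =
    IsInfimum (λ v → ∃[ A ] (A ∈ 𝔄 ε f × IsMaxExpectedCost A (zeros f) v))

{-# OPTIONS --safe #-}

-- Lower bound.  By minimax there is a distribution μ on the zeros of f on
-- which every sound algorithm for f with error ε (and bounded depth) makes at
-- least c − δ expected queries.  Run an algorithm for OR_n ∘ f on μⁿ: once all
-- blocks but one are fixed to zeros drawn from μ, what remains is an algorithm
-- for f whose cost is the number of queries made to that block.  Summing over
-- the blocks, the total cost is at least n (c − δ).
--
-- Upper bound.  Run independent copies of a near-optimal algorithm for f on the
-- blocks until one of them accepts.  Before the first block of value 1 the cost
-- is a sum of independent terms of mean at most c + δ.  If ε = 0, that block is
-- never missed and ends the run.  If ε > 0, first lower the error slightly by
-- mixing in an exact algorithm, then stop after n (c + δ) + O(1) queries: by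
-- Chebyshev's inequality this adds an error that vanishes as n grows.
--
-- Countable randomness is reduced to finite randomness by moving the tail of
-- the weights to a tree that reads the whole input.
module Submission where

open import Defs
open import Algebra.Bundles using (CommutativeRing)
import Algebra.Definitions.RawMonoid as RawMonoidDefs
import Algebra.Properties.AbelianGroup
import Algebra.Properties.Ring
import Algebra.Properties.Semiring.Mult
import Algebra.Properties.Semiring.Mult.TCOptimised
import Algebra.Solver.Ring
open import Algebra.Solver.Ring.AlmostCommutativeRing
  using (fromCommutativeRing; _-Raw-AlmostCommutative⟶_)
open import Axiom.ExcludedMiddle using (ExcludedMiddle)
open import Data.Bool.Base using (Bool; true; false; not; _∨_; _∧_; if_then_else_; T)
open import Data.Empty using (⊥; ⊥-elim)
open import Data.Fin.Base using (Fin; zero; suc; toℕ; _↑ˡ_; _↑ʳ_; splitAt)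
open import Data.Integer.Base as ℤ using (ℤ; +_; -[1+_])
import Data.Integer.Properties as ℤ
open import Data.List.Base as List using (List; []; _∷_; length)
import Data.List.Membership.Propositional as List
open import Data.List.Membership.Propositional.Properties using (∈-++⁺ˡ; ∈-++⁺ʳ; ∈-map⁺)
open import Data.List.Relation.Unary.All as All using (All; []; _∷_)
import Data.List.Relation.Unary.All.Properties as All
open import Data.List.Relation.Unary.Any using (here; there)
open import Data.Maybe.Base as Maybe using (Maybe; just; nothing)
open import Data.Maybe.Relation.Unary.Any using () renaming (just to any-just)
open import Data.Nat.Base as ℕ using (ℕ; zero; suc; z≤n; s≤s)
import Data.Nat.Properties as ℕ
open import Data.Product using (∃-syntax; Σ-syntax; _×_; _,_; proj₁; proj₂; map₁; map₂)
open import Data.Sum.Base using (_⊎_; inj₁; inj₂; [_,_]′)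
open import Data.Unit.Base using (tt)
open import Data.Vec.Base as Vec using (Vec; []; _∷_; lookup; take; drop)
open import Data.Vec.Properties
  using (lookup-++ˡ; lookup-++ʳ; lookup-splitAt; ++-injective; take++drop≡id)
open import Function.Base using (_∘_; id; const)
open import Level using (0ℓ)
open import Relation.Binary.Bundles using (Poset)
import Relation.Binary.Construct.NonStrictToStrict as ToStrict
open import Relation.Binary.PropositionalEquality as ≡ using (_≡_)
import Relation.Binary.Reasoning.PartialOrder
import Relation.Binary.Reasoning.Setoid
open import Relation.Binary.Structures using (IsTotalOrder)
open import Relation.Nullary using (¬_; yes; no; contradiction)
open import Relation.Nullary.Decidable using (dec⇒maybe)
open import Relation.Unary using (Pred; _∈_)

-- Minimax is obtained by iteration instead of compactness or linear duality: excluded middle turns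
-- the absence of a hard μ into a response function, and playing against it long enough yields an
-- algorithm cheaper than c. The iteration controls squared deviations of the cost, hence the bound
-- on the depth. That bound is read off a finite algorithm for OR_n ∘ f already at hand, so μ
-- depends on this algorithm; c does not, and only c enters the result.
--
-- Fixing the other blocks to zeros turns OR into f on the remaining block, so every block inherits
-- the full ε and nothing is shared out among the blocks. The passage to finite randomness likewise
-- keeps ε unchanged, so that both sides refer to the same c.
--
-- A block of value 1 may cost far more than c, which measures zeros only; it is charged once, as a
-- constant that disappears after division by n. The Chebyshev estimate is a recursion on blocks
-- with a squared positive part: the means are bounded from above only, so cheap runs must not count
-- as deviations.

-- Decision trees: restriction, sequencing, truncation

module Trees where

  open import Data.Vec.Base using (_++_)
  open ≡ using (refl; sym; trans; cong; cong₂)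

  private variable
    N M m n : ℕ

  allVecs : ∀ N → List (Vec Bool N)
  allVecs zero    = [] ∷ []
  allVecs (suc N) = List.map (false ∷_) (allVecs N) List.++ List.map (true ∷_) (allVecs N)

  ∈-allVecs : (x : Vec Bool N) → x List.∈ allVecs N
  ∈-allVecs []          = here refl
  ∈-allVecs (false ∷ x) = ∈-++⁺ˡ (∈-map⁺ _ (∈-allVecs x))
  ∈-allVecs (true ∷ x)  = ∈-++⁺ʳ _ (∈-map⁺ _ (∈-allVecs x))

  depth : DecisionTree N → ℕ
  depth (output _)    = 0
  depth (query _ t u) = suc (depth t ℕ.⊔ depth u)

  queries≤depth : ∀ (t : DecisionTree N) y → queries t y ℕ.≤ depth t
  queries≤depth (output _)    y = z≤n
  queries≤depth (query i t u) y with lookup y i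
  ... | true  = s≤s (ℕ.m≤n⇒m≤o⊔n (depth t) (queries≤depth u y))
  ... | false = s≤s (ℕ.m≤n⇒m≤n⊔o (depth u) (queries≤depth t y))

  -- `ρ` sends each bit either to a bit of another input or to a constant, so relabelling variables
  -- and hardwiring a block are one operation. A hardwired query disappears from the tree and hence
  -- from the cost.
  restrict : (Fin N → Fin M ⊎ Bool) → DecisionTree N → DecisionTree M
  restrict ρ (output b)    = output b
  restrict ρ (query i t u) with ρ i
  ... | inj₁ j     = query j (restrict ρ t) (restrict ρ u)
  ... | inj₂ true  = restrict ρ u
  ... | inj₂ false = restrict ρ t

  Matches : (Fin N → Fin M ⊎ Bool) → Vec Bool M → Vec Bool N → Set
  Matches ρ x y = ∀ i → lookup y i ≡ [ lookup x , id ]′ (ρ i)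

  eval-restrict : ∀ {ρ : Fin N → Fin M ⊎ Bool} {x y} → Matches ρ x y →
                  ∀ t → eval (restrict ρ t) x ≡ eval t y
  eval-restrict match (output b) = refl
  eval-restrict {ρ = ρ} {x} match (query i t u) rewrite match i with ρ i
  ... | inj₂ true  = eval-restrict match u
  ... | inj₂ false = eval-restrict match t
  ... | inj₁ j with lookup x j
  ...   | true  = eval-restrict match u
  ...   | false = eval-restrict match t

  queriesAt : (Fin N → Bool) → DecisionTree N → Vec Bool N → ℕ
  queriesAt B (output _)    y = 0
  queriesAt B (query i t u) y =
    (if B i then 1 else 0) ℕ.+ (if lookup y i then queriesAt B u y else queriesAt B t y)

  isInj₁ᵇ : {A B : Set} → A ⊎ B → Bool
  isInj₁ᵇ (inj₁ _) = true
  isInj₁ᵇ (inj₂ _) = false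

  queries-restrict : ∀ {ρ : Fin N → Fin M ⊎ Bool} {x y} → Matches ρ x y →
                     ∀ t → queries (restrict ρ t) x ≡ queriesAt (isInj₁ᵇ ∘ ρ) t y
  queries-restrict match (output b) = refl
  queries-restrict {ρ = ρ} {x} match (query i t u) rewrite match i with ρ i
  ... | inj₂ true  = queries-restrict match u
  ... | inj₂ false = queries-restrict match t
  ... | inj₁ j with lookup x j
  ...   | true  = cong suc (queries-restrict match u)
  ...   | false = cong suc (queries-restrict match t)

  queriesAt-true : ∀ {B : Fin N → Bool} → (∀ i → B i ≡ true) →
                   ∀ t y → queriesAt B t y ≡ queries t y
  queriesAt-true B≡ (output _) y = refl
  queriesAt-true B≡ (query i t u) y rewrite B≡ i with lookup y i
  ... | true  = cong suc (queriesAt-true B≡ u y)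
  ... | false = cong suc (queriesAt-true B≡ t y)

  queriesAt-split : ∀ {B C : Fin N → Bool} → (∀ i → C i ≡ not (B i)) →
                    ∀ t y → queriesAt B t y ℕ.+ queriesAt C t y ≡ queries t y
  queriesAt-split C≡ (output _) y = refl
  queriesAt-split {B = B} C≡ (query i t u) y rewrite C≡ i with B i | lookup y i
  ... | true  | true  = cong suc (queriesAt-split C≡ u y)
  ... | true  | false = cong suc (queriesAt-split C≡ t y)
  ... | false | true  = trans (ℕ.+-suc _ _) (cong suc (queriesAt-split C≡ u y))
  ... | false | false = trans (ℕ.+-suc _ _) (cong suc (queriesAt-split C≡ t y))

  rename : (Fin N → Fin M) → DecisionTree N → DecisionTree M
  rename σ = restrict (inj₁ ∘ σ)

  queries-rename : ∀ {σ : Fin N → Fin M} {x y} → (∀ i → lookup y i ≡ lookup x (σ i)) →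
                   ∀ t → queries (rename σ t) x ≡ queries t y
  queries-rename {y = y} match t =
    trans (queries-restrict match t) (queriesAt-true (λ _ → refl) t y)

  fixʳ : Vec Bool n → DecisionTree (m ℕ.+ n) → DecisionTree m
  fixʳ {m = m} z = restrict ([ inj₁ , inj₂ ∘ lookup z ]′ ∘ splitAt m)

  fixˡ : Vec Bool m → DecisionTree (m ℕ.+ n) → DecisionTree n
  fixˡ {m} x = restrict ([ inj₂ ∘ lookup x , inj₁ ]′ ∘ splitAt m)

  matchesʳ : ∀ (x : Vec Bool m) (z : Vec Bool n) →
             Matches ([ inj₁ , inj₂ ∘ lookup z ]′ ∘ splitAt m) x (x ++ z)
  matchesʳ {m} x z i rewrite lookup-splitAt m x z i with splitAt m i
  ... | inj₁ _ = refl
  ... | inj₂ _ = refl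

  matchesˡ : ∀ (x : Vec Bool m) (z : Vec Bool n) →
             Matches ([ inj₂ ∘ lookup x , inj₁ ]′ ∘ splitAt m) z (x ++ z)
  matchesˡ {m} x z i rewrite lookup-splitAt m x z i with splitAt m i
  ... | inj₁ _ = refl
  ... | inj₂ _ = refl

  eval-fixʳ : ∀ t (x : Vec Bool m) (z : Vec Bool n) → eval (fixʳ z t) x ≡ eval t (x ++ z)
  eval-fixʳ t x z = eval-restrict (matchesʳ x z) t

  eval-fixˡ : ∀ t (x : Vec Bool m) (z : Vec Bool n) → eval (fixˡ x t) z ≡ eval t (x ++ z)
  eval-fixˡ t x z = eval-restrict (matchesˡ x z) t

  -- Each query hits exactly one of the two parts, and hardwiring a part erases precisely its
  -- queries. This exact additivity lets the cost be summed over blocks.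
  queries-fix : ∀ t (x : Vec Bool m) (z : Vec Bool n) →
                queries (fixʳ z t) x ℕ.+ queries (fixˡ x t) z ≡ queries t (x ++ z)
  queries-fix {m} t x z = trans
    (cong₂ ℕ._+_ (queries-restrict (matchesʳ x z) t) (queries-restrict (matchesˡ x z) t))
    (queriesAt-split complementary t (x ++ z))
    where
    complementary : ∀ i → isInj₁ᵇ (([ inj₂ ∘ lookup x , inj₁ ]′ ∘ splitAt m) i) ≡
                          not (isInj₁ᵇ (([ inj₁ , inj₂ ∘ lookup z ]′ ∘ splitAt m) i))
    complementary i with splitAt m i
    ... | inj₁ _ = refl
    ... | inj₂ _ = refl

  depth-restrict : ∀ (ρ : Fin N → Fin M ⊎ Bool) t → depth (restrict ρ t) ℕ.≤ depth t
  depth-restrict ρ (output _) = z≤n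
  depth-restrict ρ (query i t u) with ρ i
  ... | inj₁ _     = s≤s (ℕ.⊔-mono-≤ (depth-restrict ρ t) (depth-restrict ρ u))
  ... | inj₂ true  = ℕ.m≤n⇒m≤1+n (ℕ.m≤n⇒m≤o⊔n (depth t) (depth-restrict ρ u))
  ... | inj₂ false = ℕ.m≤n⇒m≤1+n (ℕ.m≤n⇒m≤n⊔o (depth u) (depth-restrict ρ t))

  full : (Vec Bool N → Bool) → DecisionTree N
  full {zero}  φ = output (φ [])
  full {suc N} φ = query zero (rename suc (full (φ ∘ (false ∷_))))
                              (rename suc (full (φ ∘ (true ∷_))))

  eval-full : ∀ (φ : Vec Bool N → Bool) y → eval (full φ) y ≡ φ y
  eval-full φ []          = refl
  eval-full φ (false ∷ y) = trans (eval-restrict (λ _ → refl) (full (φ ∘ (false ∷_)))) (eval-full _ y)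
  eval-full φ (true ∷ y)  = trans (eval-restrict (λ _ → refl) (full (φ ∘ (true ∷_)))) (eval-full _ y)

  queries-full : ∀ (φ : Vec Bool N → Bool) y → queries (full φ) y ≡ N
  queries-full φ []          = refl
  queries-full φ (false ∷ y) =
    cong suc (trans (queries-rename (λ _ → refl) (full (φ ∘ (false ∷_)))) (queries-full _ y))
  queries-full φ (true ∷ y)  =
    cong suc (trans (queries-rename (λ _ → refl) (full (φ ∘ (true ∷_)))) (queries-full _ y))

  _else_ : DecisionTree N → DecisionTree N → DecisionTree N
  output true  else u = output true
  output false else u = u
  query i s t  else u = query i (s else u) (t else u)

  eval-else : ∀ (t u : DecisionTree N) y → eval (t else u) y ≡ eval t y ∨ eval u y
  eval-else (output true)  u y = refl
  eval-else (output false) u y = refl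
  eval-else (query i s t)  u y with lookup y i
  ... | true  = eval-else t u y
  ... | false = eval-else s u y

  queries-else : ∀ (t u : DecisionTree N) y →
    queries (t else u) y ≡ queries t y ℕ.+ (if eval t y then 0 else queries u y)
  queries-else (output true)  u y = refl
  queries-else (output false) u y = refl
  queries-else (query i s t)  u y with lookup y i
  ... | true  = cong suc (queries-else t u y)
  ... | false = cong suc (queries-else s u y)

  _then_ : DecisionTree m → DecisionTree n → DecisionTree (m ℕ.+ n)
  t then u = rename (_↑ˡ _) t else rename (_ ↑ʳ_) u

  eval-then : ∀ t u (x : Vec Bool m) (z : Vec Bool n) →
              eval (t then u) (x ++ z) ≡ eval t x ∨ eval u z
  eval-then t u x z = trans (eval-else (rename (_↑ˡ _) t) _ (x ++ z))
    (cong₂ _∨_ (eval-restrict (sym ∘ lookup-++ˡ x z) t) (eval-restrict (sym ∘ lookup-++ʳ x z) u))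

  queries-then : ∀ t u (x : Vec Bool m) (z : Vec Bool n) →
    queries (t then u) (x ++ z) ≡ queries t x ℕ.+ (if eval t x then 0 else queries u z)
  queries-then t u x z = trans (queries-else (rename (_↑ˡ _) t) _ (x ++ z))
    (cong₂ ℕ._+_ (queries-rename (sym ∘ lookup-++ˡ x z) t)
      (cong₂ (λ b k → if b then 0 else k)
        (eval-restrict (sym ∘ lookup-++ˡ x z) t) (queries-rename (sym ∘ lookup-++ʳ x z) u)))

  -- A run that is cut rejects, so truncation can create false negatives only.
  truncate : ℕ → DecisionTree N → DecisionTree N
  truncate q       (output b)    = output b
  truncate zero    (query _ _ _) = output false
  truncate (suc q) (query i t u) = query i (truncate q t) (truncate q u)

  queries-truncate : ∀ q (t : DecisionTree N) y → queries (truncate q t) y ℕ.≤ q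
  queries-truncate q       (output _)    y = z≤n
  queries-truncate zero    (query _ _ _) y = z≤n
  queries-truncate (suc q) (query i t u) y with lookup y i
  ... | true  = s≤s (queries-truncate q u y)
  ... | false = s≤s (queries-truncate q t y)

  eval-truncate-false : ∀ q (t : DecisionTree N) y → eval t y ≡ false → eval (truncate q t) y ≡ false
  eval-truncate-false q       (output _)    y e = e
  eval-truncate-false zero    (query _ _ _) y e = refl
  eval-truncate-false (suc q) (query i t u) y e with lookup y i
  ... | true  = eval-truncate-false q u y e
  ... | false = eval-truncate-false q t y e

  eval-truncate-≤ : ∀ q (t : DecisionTree N) y → queries t y ℕ.≤ q → eval (truncate q t) y ≡ eval t y
  eval-truncate-≤ q       (output _)    y le = refl
  eval-truncate-≤ (suc q) (query i t u) y (s≤s le) with lookup y i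
  ... | true  = eval-truncate-≤ q u y le
  ... | false = eval-truncate-≤ q t y le

  take-++ : ∀ (x : Vec Bool m) (z : Vec Bool n) → take m (x ++ z) ≡ x
  take-++ {m} x z = proj₁ (++-injective (take m (x ++ z)) x (take++drop≡id m (x ++ z)))

  drop-++ : ∀ (x : Vec Bool m) (z : Vec Bool n) → drop m (x ++ z) ≡ z
  drop-++ {m} x z = proj₂ (++-injective (take m (x ++ z)) x (take++drop≡id m (x ++ z)))

  OR-++ : ∀ n (f : PartialFunction m) (x : Vec Bool m) (z : Vec Bool (n ℕ.* m)) →
          (OR suc n ∘ f) (x ++ z) ≡ Maybe.zipWith _∨_ (f x) ((OR n ∘ f) z)
  OR-++ n f x z rewrite take-++ x z | drop-++ x z = refl

  zero-OR-++ : ∀ n (f : PartialFunction m) {x : Vec Bool m} {z : Vec Bool (n ℕ.* m)} →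
    f x ≡ just false → (OR n ∘ f) z ≡ just false → (OR suc n ∘ f) (x ++ z) ≡ just false
  zero-OR-++ n f {x} {z} fx fz = trans (OR-++ n f x z) (cong₂ (Maybe.zipWith _∨_) fx fz)

  zero-OR : ∀ n (f : PartialFunction m) {x : Vec Bool m} →
            f x ≡ just false → ∃[ y ] (OR n ∘ f) y ≡ just false
  zero-OR zero    f fx = [] , refl
  zero-OR (suc n) f fx = _ , zero-OR-++ n f fx (proj₂ (zero-OR n f fx))

  zipWith-∨-just : ∀ {a b c} → Maybe.zipWith _∨_ a b ≡ just c →
                   ∃[ p ] ∃[ q ] (a ≡ just p × b ≡ just q × p ∨ q ≡ c)
  zipWith-∨-just {just p} {just q} refl = p , q , refl , refl , refl
  zipWith-∨-just {nothing} ()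
  zipWith-∨-just {just _} {nothing} ()

  OR-suc : ∀ n (f : PartialFunction m) y {c} → (OR suc n ∘ f) y ≡ just c →
    ∃[ x ] ∃[ z ] ∃[ p ] ∃[ q ]
      (y ≡ x ++ z × f x ≡ just p × (OR n ∘ f) z ≡ just q × p ∨ q ≡ c)
  OR-suc {m} n f y e with zipWith-∨-just {f (take m y)} e
  ... | p , q , fx , fz , pq = _ , _ , p , q , sym (take++drop≡id m y) , fx , fz , pq

-- A ring solver with integer coefficients

module IntegerSolver (R : CommutativeRing 0ℓ 0ℓ) where

  private
    open CommutativeRing R
    open Algebra.Properties.Ring ring
    open Algebra.Properties.AbelianGroup +-abelianGroup using (⁻¹-∙-comm; ⁻¹-involutive; ε⁻¹≈ε)
    open Algebra.Properties.Semiring.Mult.TCOptimised semiring renaming (_×_ to _·_)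
    open Relation.Binary.Reasoning.Setoid setoid

    -- The multiple is the optimised one, for which 1 · 1# computes to 1# and 2 · 1# to 1# + 1#, so
    -- `con (+ 1)` and `con (+ 2)` match these terms. `fromℕ k` unfolds differently and appears in
    -- solved identities as a sum ending in `con (+ 0)`.
    ι : ℕ → Carrier
    ι n = n · 1#

    ⟦_⟧ : ℤ → Carrier
    ⟦ + n ⟧      = ι n
    ⟦ -[1+ n ] ⟧ = - ι (suc n)

    ι-suc-⊖ : ∀ m n → ι (suc m) - ι (suc n) ≈ ι m - ι n
    ι-suc-⊖ m n = begin
      ι (suc m) - ι (suc n)           ≈⟨ +-cong (1+× m 1#) (-‿cong (1+× n 1#)) ⟩
      (1# + ι m) - (1# + ι n)         ≈⟨ +-cong (+-comm 1# (ι m)) (sym (⁻¹-∙-comm 1# (ι n))) ⟩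
      (ι m + 1#) + (- 1# - ι n)       ≈⟨ +-assoc _ _ _ ⟩
      ι m + (1# + (- 1# - ι n))       ≈⟨ +-congˡ (sym (+-assoc _ _ _)) ⟩
      ι m + ((1# - 1#) - ι n)         ≈⟨ +-congˡ (+-congʳ (-‿inverseʳ 1#)) ⟩
      ι m + (0# - ι n)                ≈⟨ +-congˡ (+-identityˡ _) ⟩
      ι m - ι n                       ∎

    ⟦⟧-neg : ∀ i → ⟦ ℤ.- i ⟧ ≈ - ⟦ i ⟧
    ⟦⟧-neg (+ zero)  = sym ε⁻¹≈ε
    ⟦⟧-neg (+ suc n) = refl
    ⟦⟧-neg -[1+ n ]  = sym (⁻¹-involutive _)

    ⟦⟧-⊖ : ∀ m n → ⟦ m ℤ.⊖ n ⟧ ≈ ι m - ι n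
    ⟦⟧-⊖ m       zero    = sym (trans (+-congˡ ε⁻¹≈ε) (+-identityʳ _))
    ⟦⟧-⊖ zero    (suc n) = sym (+-identityˡ _)
    ⟦⟧-⊖ (suc m) (suc n) = begin
      ⟦ suc m ℤ.⊖ suc n ⟧  ≡⟨ ≡.cong ⟦_⟧ (ℤ.[1+m]⊖[1+n]≡m⊖n m n) ⟩
      ⟦ m ℤ.⊖ n ⟧          ≈⟨ ⟦⟧-⊖ m n ⟩
      ι m - ι n            ≈⟨ ι-suc-⊖ m n ⟨
      ι (suc m) - ι (suc n) ∎

    ⟦⟧-+ : ∀ i j → ⟦ i ℤ.+ j ⟧ ≈ ⟦ i ⟧ + ⟦ j ⟧
    ⟦⟧-+ (+ m)    (+ n)    = ×-homo-+ 1# m n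
    ⟦⟧-+ (+ m)    -[1+ n ] = ⟦⟧-⊖ m (suc n)
    ⟦⟧-+ -[1+ m ] (+ n)    = trans (⟦⟧-⊖ n (suc m)) (+-comm _ _)
    ⟦⟧-+ -[1+ m ] -[1+ n ] = begin
      - ι (suc (suc (m ℕ.+ n)))    ≡⟨ ≡.cong (λ k → - ι (suc k)) (≡.sym (ℕ.+-suc m n)) ⟩
      - ι (suc m ℕ.+ suc n)        ≈⟨ -‿cong (×-homo-+ 1# (suc m) (suc n)) ⟩
      - (ι (suc m) + ι (suc n))    ≈⟨ ⁻¹-∙-comm _ _ ⟨
      - ι (suc m) - ι (suc n)      ∎

    ⟦⟧-* : ∀ i j → ⟦ i ℤ.* j ⟧ ≈ ⟦ i ⟧ * ⟦ j ⟧
    ⟦⟧-* (+ m) (+ n) = trans (reflexive (≡.cong ⟦_⟧ (ℤ.+◃n≡+n (m ℕ.* n)))) (×1-homo-* m n)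
    ⟦⟧-* (+ m) -[1+ n ] = begin
      ⟦ (+ m) ℤ.* -[1+ n ] ⟧       ≡⟨ ≡.cong ⟦_⟧ (ℤ.-◃n≡-n (m ℕ.* suc n)) ⟩
      ⟦ ℤ.- (+ (m ℕ.* suc n)) ⟧    ≈⟨ ⟦⟧-neg (+ (m ℕ.* suc n)) ⟩
      - ι (m ℕ.* suc n)            ≈⟨ -‿cong (×1-homo-* m (suc n)) ⟩
      - (ι m * ι (suc n))          ≈⟨ -‿distribʳ-* _ _ ⟩
      ι m * - ι (suc n)            ∎
    ⟦⟧-* -[1+ m ] (+ n) = begin
      ⟦ -[1+ m ] ℤ.* (+ n) ⟧       ≡⟨ ≡.cong ⟦_⟧ (ℤ.-◃n≡-n (suc m ℕ.* n)) ⟩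
      ⟦ ℤ.- (+ (suc m ℕ.* n)) ⟧    ≈⟨ ⟦⟧-neg (+ (suc m ℕ.* n)) ⟩
      - ι (suc m ℕ.* n)            ≈⟨ -‿cong (×1-homo-* (suc m) n) ⟩
      - (ι (suc m) * ι n)          ≈⟨ -‿distribˡ-* _ _ ⟩
      - ι (suc m) * ι n            ∎
    ⟦⟧-* -[1+ m ] -[1+ n ] = begin
      ι (suc m ℕ.* suc n)              ≈⟨ ×1-homo-* (suc m) (suc n) ⟩
      ι (suc m) * ι (suc n)            ≈⟨ ⁻¹-involutive _ ⟨
      - - (ι (suc m) * ι (suc n))      ≈⟨ -‿cong (-‿distribˡ-* _ _) ⟩
      - (- ι (suc m) * ι (suc n))      ≈⟨ -‿distribʳ-* _ _ ⟩
      - ι (suc m) * - ι (suc n)        ∎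

    morphism : ℤ.+-*-rawRing -Raw-AlmostCommutative⟶ fromCommutativeRing R
    morphism = record
      { ⟦_⟧ = ⟦_⟧ ; +-homo = ⟦⟧-+ ; *-homo = ⟦⟧-* ; -‿homo = ⟦⟧-neg
      ; 0-homo = refl ; 1-homo = refl }

    _≟_ : ∀ i j → Maybe (⟦ i ⟧ ≈ ⟦ j ⟧)
    i ≟ j = Maybe.map (λ eq → reflexive (≡.cong ⟦_⟧ eq)) (dec⇒maybe (i ℤ.≟ j))

  open Algebra.Solver.Ring ℤ.+-*-rawRing (fromCommutativeRing R) morphism _≟_ public
    using (Polynomial; solve; _:=_; _:+_; _:*_; _:-_; :-_; con)

-- Order, completeness and the Archimedean property

module OrderedField (em : ExcludedMiddle 0ℓ) (ℝ : CompleteOrderedField) where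

  open QueryComplexity ℝ public
  open CommutativeRing commutativeRing public
    using (refl; sym; trans; reflexive; +-cong; +-congˡ; +-congʳ; *-congˡ; *-congʳ;
           -‿cong; +-identityˡ; +-identityʳ; *-identityˡ; *-identityʳ; zeroˡ; zeroʳ; +-comm;
           *-comm; *-assoc; distribʳ; semiring)
  open RawMonoidDefs +-rawMonoid public using (sum)
  open IntegerSolver commutativeRing public
  open IsTotalOrder isTotalOrder public
    using (total) renaming (refl to ≤-refl; reflexive to ≤-reflexive; trans to ≤-trans; antisym to ≤-antisym)
  poset : Poset 0ℓ 0ℓ 0ℓ
  poset = record { isPartialOrder = IsTotalOrder.isPartialOrder isTotalOrder }
  module ≤-Reasoning = Relation.Binary.Reasoning.PartialOrder poset
  open Algebra.Properties.Semiring.Mult semiring using (×-homo-+; ×1-homo-*)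

  private variable
    x y z a b s t δ : Carrier
    n k : ℕ

  ≰⇒> : ¬ x ≤ y → y < x
  ≰⇒> = ToStrict.≰⇒> _≈_ _≤_ sym ≤-reflexive total

  <⇒≱ : x < y → ¬ y ≤ x
  <⇒≱ = ToStrict.<⇒≱ _≈_ _≤_ ≤-antisym

  abstract
    _≤?_ : ∀ x y → x ≤ y ⊎ y < x
    x ≤? y with em {x ≤ y}
    ... | yes x≤y = inj₁ x≤y
    ... | no  x≰y = inj₂ (≰⇒> x≰y)

  ≤-by-contradiction : ¬ y < x → x ≤ y
  ≤-by-contradiction {y} {x} ¬y<x with x ≤? y
  ... | inj₁ x≤y = x≤y
  ... | inj₂ y<x = contradiction y<x ¬y<x

  <-≤-trans : x < y → y ≤ z → x < z
  <-≤-trans x<y y≤z = ≰⇒> λ z≤x → <⇒≱ x<y (≤-trans y≤z z≤x)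

  ≤-<-trans : x ≤ y → y < z → x < z
  ≤-<-trans x≤y y<z = ≰⇒> λ z≤x → <⇒≱ y<z (≤-trans z≤x x≤y)

  0≤-diff : x ≤ y → 0# ≤ y - x
  0≤-diff {x} {y} x≤y = begin
    0#      ≈⟨ solve 1 (λ x → con (+ 0) := x :- x) refl x ⟩
    x - x   ≤⟨ +-monoˡ-≤ (- x) x≤y ⟩
    y - x   ∎
    where open ≤-Reasoning

  -- Inequalities are reduced to ring identities: y − x is exhibited as a
  -- visibly nonnegative expression.
  0≤-diff⁻¹ : 0# ≤ t → t ≈ y - x → x ≤ y
  0≤-diff⁻¹ {t} {y} {x} 0≤t t≈y-x = begin
    x           ≈⟨ +-identityˡ x ⟨
    0# + x      ≤⟨ +-monoˡ-≤ x 0≤t ⟩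
    t + x       ≈⟨ +-congʳ t≈y-x ⟩
    y - x + x   ≈⟨ solve 2 (λ x y → y :- x :+ x := y) refl x y ⟩
    y           ∎
    where open ≤-Reasoning

  +-mono-≤ : x ≤ y → s ≤ t → x + s ≤ y + t
  +-mono-≤ {x} {y} {s} {t} x≤y s≤t = begin
    x + s  ≤⟨ +-monoˡ-≤ s x≤y ⟩
    y + s  ≈⟨ +-comm y s ⟩
    s + y  ≤⟨ +-monoˡ-≤ y s≤t ⟩
    t + y  ≈⟨ +-comm t y ⟩
    y + t  ∎
    where open ≤-Reasoning

  +-monoʳ-≤ : ∀ x → s ≤ t → x + s ≤ x + t
  +-monoʳ-≤ x = +-mono-≤ ≤-refl

  +-nonneg : 0# ≤ x → 0# ≤ y → 0# ≤ x + y
  +-nonneg {x} {y} 0≤x 0≤y = begin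
    0#       ≈⟨ +-identityʳ 0# ⟨
    0# + 0#  ≤⟨ +-mono-≤ 0≤x 0≤y ⟩
    x + y    ∎
    where open ≤-Reasoning

  *-monoʳ-≤ : 0# ≤ a → x ≤ y → a * x ≤ a * y
  *-monoʳ-≤ {a} {x} {y} 0≤a x≤y = 0≤-diff⁻¹ (*-nonneg 0≤a (0≤-diff x≤y))
    (solve 3 (λ a x y → a :* (y :- x) := a :* y :- a :* x) refl a x y)

  *-monoˡ-≤ : 0# ≤ a → x ≤ y → x * a ≤ y * a
  *-monoˡ-≤ {a} {x} {y} 0≤a x≤y = 0≤-diff⁻¹ (*-nonneg 0≤a (0≤-diff x≤y))
    (solve 3 (λ a x y → a :* (y :- x) := y :* a :- x :* a) refl a x y)

  *-mono-≤ : 0# ≤ x → x ≤ y → 0# ≤ s → s ≤ t → x * s ≤ y * t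
  *-mono-≤ 0≤x x≤y 0≤s s≤t = ≤-trans (*-monoʳ-≤ 0≤x s≤t) (*-monoˡ-≤ (≤-trans 0≤s s≤t) x≤y)

  square-nonneg : ∀ x → 0# ≤ x * x
  square-nonneg x with total 0# x
  ... | inj₁ 0≤x = *-nonneg 0≤x 0≤x
  ... | inj₂ x≤0 = ≤-trans (*-nonneg (0≤-diff x≤0) (0≤-diff x≤0))
    (≤-reflexive (solve 1 (λ x → (con (+ 0) :- x) :* (con (+ 0) :- x) := x :* x) refl x))

  0≤1 : 0# ≤ 1#
  0≤1 = ≤-trans (square-nonneg 1#) (≤-reflexive (*-identityʳ 1#))

  0<1 : 0# < 1#
  0<1 = 0≤1 , 0≉1

  fromℕ-+ : ∀ m n → fromℕ (m ℕ.+ n) ≈ fromℕ m + fromℕ n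
  fromℕ-+ = ×-homo-+ 1#

  fromℕ-nonneg : ∀ n → 0# ≤ fromℕ n
  fromℕ-nonneg zero    = ≤-refl
  fromℕ-nonneg (suc n) = +-nonneg 0≤1 (fromℕ-nonneg n)

  fromℕ-mono : n ℕ.≤ k → fromℕ n ≤ fromℕ k
  fromℕ-mono {k = k} z≤n = fromℕ-nonneg k
  fromℕ-mono (s≤s n≤k) = +-monoʳ-≤ 1# (fromℕ-mono n≤k)

  x≤x+y : 0# ≤ y → x ≤ x + y
  x≤x+y {y} {x} 0≤y = 0≤-diff⁻¹ 0≤y (solve 2 (λ x y → y := x :+ y :- x) refl x y)

  0<suc : ∀ n → 0# < fromℕ (suc n)
  0<suc n = <-≤-trans 0<1 (x≤x+y (fromℕ-nonneg n))

  >-nonzero : 0# < x → ¬ x ≈ 0#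
  >-nonzero (_ , 0≉x) x≈0 = 0≉x (sym x≈0)

  ⁻¹-nonneg : 0# < x → 0# ≤ x ⁻¹
  ⁻¹-nonneg {x} 0<x = ≤-by-contradiction λ x⁻¹<0 → <⇒≱ 0<1 (begin
    1#                    ≈⟨ ⁻¹-inverseʳ x (>-nonzero 0<x) ⟨
    x * x ⁻¹              ≤⟨ *-monoʳ-≤ (proj₁ 0<x) (proj₁ x⁻¹<0) ⟩
    x * 0#                ≈⟨ zeroʳ x ⟩
    0#                    ∎)
    where open ≤-Reasoning

  *-cancelˡ-≤ : 0# < a → a * x ≤ a * y → x ≤ y
  *-cancelˡ-≤ {a} {x} {y} 0<a ax≤ay = begin
    x                ≈⟨ cancel x ⟨
    a ⁻¹ * (a * x)   ≤⟨ *-monoʳ-≤ (⁻¹-nonneg 0<a) ax≤ay ⟩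
    a ⁻¹ * (a * y)   ≈⟨ cancel y ⟩
    y                ∎
    where
    open ≤-Reasoning
    cancel : ∀ z → a ⁻¹ * (a * z) ≈ z
    cancel z = trans (solve 3 (λ a b z → b :* (a :* z) := (a :* b) :* z) refl a (a ⁻¹) z)
      (trans (*-congʳ (⁻¹-inverseʳ a (>-nonzero 0<a))) (*-identityˡ z))

  *-pos : 0# < x → 0# < y → 0# < x * y
  *-pos {x} {y} 0<x 0<y = ≰⇒> λ xy≤0 →
    <⇒≱ 0<y (*-cancelˡ-≤ 0<x (≤-trans xy≤0 (≤-reflexive (sym (zeroʳ x)))))

  ⁻¹-pos : 0# < x → 0# < x ⁻¹
  ⁻¹-pos {x} 0<x = ≰⇒> λ x⁻¹≤0 → <⇒≱ 0<1 (begin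
    1#         ≈⟨ ⁻¹-inverseʳ x (>-nonzero 0<x) ⟨
    x * x ⁻¹   ≤⟨ *-monoʳ-≤ (proj₁ 0<x) x⁻¹≤0 ⟩
    x * 0#     ≈⟨ zeroʳ x ⟩
    0#         ∎)
    where open ≤-Reasoning

  +-pos-< : 0# < δ → x < x + δ
  +-pos-< {δ} {x} 0<δ = ≰⇒> λ x+δ≤x → <⇒≱ 0<δ (0≤-diff⁻¹ (0≤-diff x+δ≤x)
    (solve 2 (λ x δ → x :- (x :+ δ) := con (+ 0) :- δ) refl x δ))

  minus-pos-< : 0# < δ → x - δ < x
  minus-pos-< {δ} {x} 0<δ = ≰⇒> λ x≤x-δ → <⇒≱ 0<δ (0≤-diff⁻¹ (0≤-diff x≤x-δ)
    (solve 2 (λ x δ → x :- δ :- x := con (+ 0) :- δ) refl x δ))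

  diff-pos : x < y → 0# < y - x
  diff-pos {x} {y} x<y = ≰⇒> λ y-x≤0 → <⇒≱ x<y (0≤-diff⁻¹ (0≤-diff y-x≤0)
    (solve 2 (λ x y → con (+ 0) :- (y :- x) := x :- y) refl x y))

  -- A supremum `s` of the naturals would not be least: n + 1 ≤ s for all n makes s - 1 an upper
  -- bound as well.
  naturals-unbounded : ∀ x → ¬ (∀ n → fromℕ n ≤ x)
  naturals-unbounded x bound with supremum (λ y → ∃[ n ] y ≡ fromℕ n) (0# , 0 , ≡.refl)
                                           (x , λ { _ (n , ≡.refl) → bound n })
  ... | s , upper , least = <⇒≱ (minus-pos-< 0<1) (least (s - 1#) λ
    { _ (n , ≡.refl) → 0≤-diff⁻¹ (0≤-diff (upper _ (suc n , ≡.refl)))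
        (solve 2 (λ s n → s :- (con (+ 1) :+ n) := s :- con (+ 1) :- n) refl s (fromℕ n)) })

  abstract
    archimedean : ∀ x → ∃[ n ] x ≤ fromℕ n
    archimedean x with em {∃[ n ] x ≤ fromℕ n}
    ... | yes p = p
    ... | no ¬p = ⊥-elim (naturals-unbounded x λ n → ≤-by-contradiction λ x<n → ¬p (n , proj₁ x<n))

  minimumℕ : (P : Pred ℕ 0ℓ) → ∀ n → P n → ∃[ k ] IsMinimum P k
  minimumℕ P n Pn = search n n ℕ.≤-refl Pn
    where
    search : ∀ fuel n → n ℕ.≤ fuel → P n → ∃[ k ] IsMinimum P k
    search fuel n n≤ Pn with em {∃[ j ] (P j × j ℕ.< n)}
    ... | no ¬smaller = n , Pn , λ j Pj → ℕ.≮⇒≥ λ j<n → ¬smaller (j , Pj , j<n)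
    search zero      _ z≤n _ | yes (_ , _ , ())
    search (suc fuel) n n≤ _ | yes (j , Pj , j<n) = search fuel j (ℕ.≤-pred (ℕ.≤-trans j<n n≤)) Pj

  -- The maximum is the least upper bound: were it not attained, its predecessor would still be an
  -- upper bound, and a bound of 0 is attained by the given witness.
  maximumℕ : (P : Pred ℕ 0ℓ) → ∃[ n ] P n → ∀ b → (∀ n → P n → n ℕ.≤ b) →
             ∃[ k ] (P k × ∀ n → P n → n ℕ.≤ k)
  maximumℕ P (n , Pn) b bound with minimumℕ (λ k → ∀ n → P n → n ℕ.≤ k) b bound
  ... | k , max , least with em {P k}
  ...   | yes Pk = k , Pk , max
  ...   | no ¬Pk = ⊥-elim (contra k max least ¬Pk)
    where
    contra : ∀ k → (∀ n → P n → n ℕ.≤ k) → (∀ j → (∀ n → P n → n ℕ.≤ j) → k ℕ.≤ j) → ¬ P k → ⊥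
    contra zero    max least ¬Pk with max n Pn
    ... | z≤n = ¬Pk Pn
    contra (suc k) max least ¬Pk = ℕ.1+n≰n (least k λ j Pj →
      ℕ.≤-pred (ℕ.≤∧≢⇒< (max j Pj) λ { ≡.refl → ¬Pk Pj }))

  abstract
    ceiling : 0# ≤ x → ∃[ n ] (x ≤ fromℕ n × fromℕ n ≤ x + 1#)
    ceiling {x} 0≤x with minimumℕ (λ n → x ≤ fromℕ n) (proj₁ (archimedean x)) (proj₂ (archimedean x))
    ... | zero  , x≤n , _     = zero , x≤n , +-nonneg 0≤x 0≤1
    ... | suc n , x≤n , least = suc n , x≤n , ≤-trans (+-monoʳ-≤ 1# n≤x) (≤-reflexive (+-comm 1# x))
      where
      n≤x : fromℕ n ≤ x
      n≤x = ≤-by-contradiction λ x<n → ℕ.1+n≰n (least n (proj₁ x<n))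

  infimum : (S : Pred Carrier 0ℓ) → ∃[ x ] x ∈ S → ∀ b → (∀ x → x ∈ S → b ≤ x) → ∃[ s ] IsInfimum S s
  infimum S (x , x∈S) b bound with supremum (λ b → ∀ x → x ∈ S → b ≤ x) (b , bound) (x , λ _ lower → lower x x∈S)
  ... | s , upper , least = s , (λ x x∈S → least x λ _ lower → lower x x∈S) , upper

  abstract
    approaches-infimum : ∀ {S s} → IsInfimum S s → 0# < δ → ∃[ x ] (x ∈ S × x ≤ s + δ)
    approaches-infimum {δ} {S} {s} (lower , greatest) 0<δ with em {∃[ x ] (x ∈ S × x ≤ s + δ)}
    ... | yes p = p
    ... | no ¬p = ⊥-elim (<⇒≱ (+-pos-< 0<δ) (greatest _ λ x x∈S →
      ≤-by-contradiction λ x<s+δ → ¬p (x , x∈S , proj₁ x<s+δ)))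

    -- Splits a tolerance δ into k portions; dividing by k + 1 covers k = 0.
    small-multiple : ∀ k → 0# < δ → ∃[ η ] (0# < η × fromℕ k * η ≤ δ)
    small-multiple {δ} k 0<δ = δ * K ⁻¹ , *-pos 0<δ (⁻¹-pos (0<suc k)) , (begin
      fromℕ k * (δ * K ⁻¹)  ≤⟨ *-monoˡ-≤ (*-nonneg (proj₁ 0<δ) (⁻¹-nonneg (0<suc k))) (fromℕ-mono (ℕ.n≤1+n k)) ⟩
      K * (δ * K ⁻¹)        ≈⟨ solve 3 (λ a b c → a :* (b :* c) := b :* (a :* c)) refl K δ (K ⁻¹) ⟩
      δ * (K * K ⁻¹)        ≈⟨ *-congˡ (⁻¹-inverseʳ K (>-nonzero (0<suc k))) ⟩
      δ * 1#                ≈⟨ *-identityʳ δ ⟩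
      δ                     ∎)
      where
      open ≤-Reasoning
      K : Carrier
      K = fromℕ (suc k)

  ≤-from-slack : (∀ δ → 0# < δ → x ≤ y + δ) → x ≤ y
  ≤-from-slack {x} {y} slack = ≤-by-contradiction λ y<x →
    let η , 0<η , 2η≤x-y = small-multiple 2 (diff-pos y<x)
        x≤y+η = slack η 0<η
    in <⇒≱ y<x (0≤-diff⁻¹ (+-nonneg (+-nonneg (0≤-diff x≤y+η) (0≤-diff x≤y+η)) (0≤-diff 2η≤x-y))
      (solve 3 (λ x y η → (y :+ η :- x) :+ (y :+ η :- x) :+
                          (x :- y :- (con (+ 1) :+ (con (+ 1) :+ con (+ 0))) :* η) := y :- x) refl x y η))

  archimedean-* : ∀ x → 0# < δ → ∃[ n ] x ≤ fromℕ n * δ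
  archimedean-* {δ} x 0<δ with archimedean (x * δ ⁻¹)
  ... | n , le = n , (begin
    x                 ≈⟨ *-identityʳ x ⟨
    x * 1#            ≈⟨ *-congˡ (⁻¹-inverseʳ δ (>-nonzero 0<δ)) ⟨
    x * (δ * δ ⁻¹)    ≈⟨ solve 3 (λ a b c → a :* (b :* c) := (a :* c) :* b) refl x δ (δ ⁻¹) ⟩
    (x * δ ⁻¹) * δ    ≤⟨ *-monoˡ-≤ (proj₁ 0<δ) le ⟩
    fromℕ n * δ       ∎)
    where open ≤-Reasoning

  -- Positive parts and their squares

  _⁺ : Carrier → Carrier
  x ⁺ with total x 0#
  ... | inj₁ _ = 0#
  ... | inj₂ _ = x

  ⁺-nonneg : ∀ x → 0# ≤ x ⁺
  ⁺-nonneg x with total x 0#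
  ... | inj₁ _   = ≤-refl
  ... | inj₂ 0≤x = 0≤x

  ≤⁺ : ∀ x → x ≤ x ⁺
  ≤⁺ x with total x 0#
  ... | inj₁ x≤0 = x≤0
  ... | inj₂ _   = ≤-refl

  ⁺-least : x ≤ y → 0# ≤ y → x ⁺ ≤ y
  ⁺-least {x} x≤y 0≤y with total x 0#
  ... | inj₁ _ = 0≤y
  ... | inj₂ _ = x≤y

  ⁺-mono : x ≤ y → x ⁺ ≤ y ⁺
  ⁺-mono {x} {y} x≤y = ⁺-least (≤-trans x≤y (≤⁺ y)) (⁺-nonneg y)

  infix 8 _⁺²
  _⁺² : Carrier → Carrier
  x ⁺² = x ⁺ * x ⁺

  ⁺²-mono : x ≤ y → x ⁺² ≤ y ⁺²
  ⁺²-mono {x} x≤y = *-mono-≤ (⁺-nonneg x) (⁺-mono x≤y) (⁺-nonneg x) (⁺-mono x≤y)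

  square≤⁺² : 0# ≤ x → x ≤ y → x * x ≤ y ⁺²
  square≤⁺² {x} {y} 0≤x x≤y = *-mono-≤ 0≤x (≤-trans x≤y (≤⁺ y)) 0≤x (≤-trans x≤y (≤⁺ y))

  -- Comes from (a + b)⁺ ≤ |a⁺ + b|. The middle term is linear in b with a nonnegative coefficient,
  -- so an upper bound on the mean of b controls the mean growth; this drives both the minimax
  -- iteration and the concentration bound.
  ⁺²-+ : ∀ a b → (a + b) ⁺² ≤ a ⁺² + (1# + 1#) * (a ⁺ * b) + b * b
  ⁺²-+ a b with total (a + b) 0#
  ... | inj₁ _ = begin
    0# * 0#                                   ≈⟨ zeroʳ 0# ⟩
    0#                                        ≤⟨ square-nonneg (a ⁺ + b) ⟩
    (a ⁺ + b) * (a ⁺ + b)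
        ≈⟨ solve 2 (λ a b → (a :+ b) :* (a :+ b) := a :* a :+ con (+ 2) :* (a :* b) :+ b :* b) refl (a ⁺) b ⟩
    a ⁺² + (1# + 1#) * (a ⁺ * b) + b * b      ∎
    where open ≤-Reasoning
  ... | inj₂ 0≤a+b = begin
    (a + b) * (a + b)                         ≤⟨ *-mono-≤ 0≤a+b le 0≤a+b le ⟩
    (a ⁺ + b) * (a ⁺ + b)
        ≈⟨ solve 2 (λ a b → (a :+ b) :* (a :+ b) := a :* a :+ con (+ 2) :* (a :* b) :+ b :* b) refl (a ⁺) b ⟩
    a ⁺² + (1# + 1#) * (a ⁺ * b) + b * b      ∎
    where
    open ≤-Reasoning
    le = +-monoˡ-≤ b (≤⁺ a)

  -- Partial sums and limits

  psum : (ℕ → Carrier) → ℕ → Carrier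
  psum a zero    = 0#
  psum a (suc k) = a 0 + psum (a ∘ suc) k

  sum≡psum : ∀ a k → sum {k} (λ i → a (toℕ i)) ≡ psum a k
  sum≡psum a zero    = ≡.refl
  sum≡psum a (suc k) = ≡.cong (λ x → a 0 + x) (sum≡psum (a ∘ suc) k)

  psum-snoc : ∀ a k → psum a (suc k) ≈ psum a k + a k
  psum-snoc a zero    = +-comm _ _
  psum-snoc a (suc k) = trans (+-congˡ (psum-snoc (a ∘ suc) k))
    (solve 3 (λ x y z → x :+ (y :+ z) := x :+ y :+ z) refl (a 0) (psum (a ∘ suc) k) (a (suc k)))

  psum-mono : ∀ {a : ℕ → Carrier} → (∀ i → 0# ≤ a i) → n ℕ.≤ k → psum a n ≤ psum a k
  psum-mono {k = zero}  0≤a z≤n       = ≤-refl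
  psum-mono {k = suc k} 0≤a z≤n       = +-nonneg (0≤a 0) (psum-mono (0≤a ∘ suc) (z≤n {k}))
  psum-mono             0≤a (s≤s n≤k) = +-monoʳ-≤ _ (psum-mono (0≤a ∘ suc) n≤k)

  psum-≤ : ∀ {a b : ℕ → Carrier} → (∀ i → a i ≤ b i) → ∀ k → psum a k ≤ psum b k
  psum-≤ a≤b zero    = ≤-refl
  psum-≤ a≤b (suc k) = +-mono-≤ (a≤b 0) (psum-≤ (a≤b ∘ suc) k)

  psum-cong : ∀ {a b : ℕ → Carrier} → (∀ i → a i ≈ b i) → ∀ k → psum a k ≈ psum b k
  psum-cong a≈b zero    = refl
  psum-cong a≈b (suc k) = +-cong (a≈b 0) (psum-cong (a≈b ∘ suc) k)

  psum-zero : ∀ {a : ℕ → Carrier} → (∀ i → a i ≈ 0#) → ∀ k → psum a k ≈ 0#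
  psum-zero a≈0 zero    = refl
  psum-zero a≈0 (suc k) = trans (+-cong (a≈0 0) (psum-zero (a≈0 ∘ suc) k)) (+-identityʳ 0#)

  psum-*ʳ : ∀ (a : ℕ → Carrier) b k → psum (λ i → a i * b) k ≈ psum a k * b
  psum-*ʳ a b zero    = sym (zeroˡ b)
  psum-*ʳ a b (suc k) = trans (+-congˡ (psum-*ʳ (a ∘ suc) b k)) (sym (distribʳ b (a 0) _))

  -- Partial sums increase, so one that exceeded s would keep all later ones away from s by the same
  -- gap.
  psum≤limit : ∀ (a : ℕ → Carrier) → (∀ i → 0# ≤ a i) → SumsTo a s → ∀ k → psum a k ≤ s
  psum≤limit {s} a 0≤a lim k = ≤-by-contradiction λ s<p →
    let N , conv = lim _ (diff-pos s<p)
    in <⇒≱ (proj₂ (conv (N ℕ.⊔ k) (ℕ.m≤m⊔n N k))) (begin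
      s + (psum a k - s)                    ≈⟨ solve 2 (λ s p → s :+ (p :- s) := p) refl s (psum a k) ⟩
      psum a k                              ≤⟨ psum-mono 0≤a (ℕ.m≤n⊔m N k) ⟩
      psum a (N ℕ.⊔ k)                      ≡⟨ sum≡psum a (N ℕ.⊔ k) ⟨
      sum {N ℕ.⊔ k} (λ i → a (toℕ i))       ∎)
    where open ≤-Reasoning

  term≤limit : ∀ (a : ℕ → Carrier) → (∀ i → 0# ≤ a i) → SumsTo a s → ∀ k → a k ≤ s
  term≤limit {s} a 0≤a lim k = begin
    a k               ≈⟨ +-identityˡ (a k) ⟨
    0# + a k          ≤⟨ +-monoˡ-≤ (a k) (psum-mono 0≤a (z≤n {k})) ⟩
    psum a k + a k    ≈⟨ psum-snoc a k ⟨
    psum a (suc k)    ≤⟨ psum≤limit a 0≤a lim (suc k) ⟩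
    s                 ∎
    where open ≤-Reasoning

  eventually-SumsTo : ∀ (a : ℕ → Carrier) K → (∀ k → K ℕ.≤ k → psum a k ≈ s) → SumsTo a s
  eventually-SumsTo {s} a K ev δ 0<δ = K , λ k K≤k →
    let eq = trans (reflexive (sum≡psum a k)) (ev k K≤k) in
    <-≤-trans (minus-pos-< 0<δ) (≤-reflexive (sym eq)) ,
    ≤-<-trans (≤-reflexive eq) (+-pos-< 0<δ)

  abstract
    psum-close : ∀ (a : ℕ → Carrier) → SumsTo a s → 0# < δ → ∃[ K ] s - δ ≤ psum a K
    psum-close a lim 0<δ with lim _ 0<δ
    ... | K , close = K , ≤-trans (proj₁ (proj₁ (close K ℕ.≤-refl))) (≤-reflexive (reflexive (sum≡psum a K)))

  squeeze : ∀ {a : ℕ → Carrier} {c} → (∀ n → fromℕ n * c ≤ a n) →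
    (∀ δ → 0# < δ → ∃[ N ] (∀ n → N ℕ.≤ n → a n ≤ fromℕ n * (c + δ))) →
    (λ n → a n / n) ⟶ c
  -- Half of δ goes into the bound from above; the other half makes the final inequality strict.
  squeeze {a} {c} lower upper δ 0<δ with small-multiple 2 0<δ
  ... | η , 0<η , 2η≤δ with upper η 0<η
  -- At least 1, because the quotient is meaningless at n = 0.
  ...   | N , up = N ℕ.⊔ 1 , λ n N≤n → bounds n (ℕ.m⊔n≤o⇒m≤o N 1 N≤n) (ℕ.m⊔n≤o⇒n≤o N 1 N≤n)
    where
    open ≤-Reasoning
    cancel : ∀ n y → (fromℕ (suc n) * y) / suc n ≈ y
    cancel n y = trans (solve 3 (λ a b c → a :* b :* c := b :* (a :* c)) refl (fromℕ (suc n)) y (fromℕ (suc n) ⁻¹))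
      (trans (*-congˡ (⁻¹-inverseʳ _ (>-nonzero (0<suc n)))) (*-identityʳ y))
    bounds : ∀ n → N ℕ.≤ n → 1 ℕ.≤ n → (c - δ < a n / n) × (a n / n < c + δ)
    bounds (suc n) N≤n _ =
      <-≤-trans (minus-pos-< 0<δ) (begin
        c                                ≈⟨ cancel n c ⟨
        (fromℕ (suc n) * c) / suc n      ≤⟨ *-monoˡ-≤ (⁻¹-nonneg (0<suc n)) (lower (suc n)) ⟩
        a (suc n) / suc n                ∎) ,
      (begin-strict
        a (suc n) / suc n                ≤⟨ *-monoˡ-≤ (⁻¹-nonneg (0<suc n)) (up (suc n) N≤n) ⟩
        (fromℕ (suc n) * (c + η)) / suc n ≈⟨ cancel n (c + η) ⟩
        c + η                            <⟨ +-pos-< 0<η ⟩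
        c + η + η
            ≈⟨ solve 2 (λ c η → c :+ η :+ η := c :+ (con (+ 1) :+ (con (+ 1) :+ con (+ 0))) :* η) refl c η ⟩
        c + fromℕ 2 * η                  ≤⟨ +-monoʳ-≤ c 2η≤δ ⟩
        c + δ                            ∎)

-- Finitely supported measures and expectations

module Distributions (em : ExcludedMiddle 0ℓ) (ℝ : CompleteOrderedField) where

  open import Data.List.Base using (_++_)
  open OrderedField em ℝ public

  private variable
    X Y Z : Set

  -- Atoms may repeat and weights are arbitrary field elements, so linearity and products hold as
  -- plain list identities, with no merging of equal atoms.
  Measure : Set → Set
  Measure X = List (Carrier × X)

  E : Measure X → (X → Carrier) → Carrier
  E []            h = 0#
  E ((w , x) ∷ l) h = w * h x + E l h

  NonNeg : Measure X → Set
  NonNeg = All ((0# ≤_) ∘ proj₁)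

  Supp : Pred X 0ℓ → Measure X → Set
  Supp P = All (P ∘ proj₂)

  total-mass : Measure X → Carrier
  total-mass l = E l (const 1#)

  record Dist (X : Set) : Set where
    constructor dist
    field
      atoms  : Measure X
      nonneg : NonNeg atoms
      mass   : total-mass atoms ≈ 1#
  open Dist public

  E-mono : ∀ {l : Measure X} {h k} → NonNeg l → Supp (λ x → h x ≤ k x) l → E l h ≤ E l k
  E-mono []        []        = ≤-refl
  E-mono (0≤w ∷ p) (h≤k ∷ q) = +-mono-≤ (*-monoʳ-≤ 0≤w h≤k) (E-mono p q)

  E-mono′ : ∀ {l : Measure X} {h k} → NonNeg l → (∀ x → h x ≤ k x) → E l h ≤ E l k
  E-mono′ p h≤k = E-mono p (All.universal (h≤k ∘ proj₂) _)

  E-cong-Supp : ∀ {l : Measure X} {h k} → Supp (λ x → h x ≈ k x) l → E l h ≈ E l k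
  E-cong-Supp []        = refl
  E-cong-Supp (h≈k ∷ q) = +-cong (*-congˡ h≈k) (E-cong-Supp q)

  E-cong : ∀ (l : Measure X) {h k} → (∀ x → h x ≈ k x) → E l h ≈ E l k
  E-cong l h≈k = E-cong-Supp (All.universal (h≈k ∘ proj₂) l)

  E-+ : ∀ (l : Measure X) h k → E l (λ x → h x + k x) ≈ E l h + E l k
  E-+ []            h k = sym (+-identityʳ 0#)
  E-+ ((w , x) ∷ l) h k = trans (+-congˡ (E-+ l h k))
    (solve 5 (λ w a b c d → w :* (a :+ b) :+ (c :+ d) := (w :* a :+ c) :+ (w :* b :+ d)) refl
      w (h x) (k x) (E l h) (E l k))

  E-*ˡ : ∀ (l : Measure X) a h → E l (λ x → a * h x) ≈ a * E l h
  E-*ˡ []            a h = sym (zeroʳ a)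
  E-*ˡ ((w , x) ∷ l) a h = trans (+-congˡ (E-*ˡ l a h))
    (solve 4 (λ w a b c → w :* (a :* b) :+ a :* c := a :* (w :* b :+ c)) refl w a (h x) (E l h))

  E-const : ∀ (l : Measure X) a → E l (const a) ≈ a * total-mass l
  E-const l a = trans (E-cong l (λ _ → sym (*-identityʳ a))) (E-*ˡ l a (const 1#))

  E-dist-const : ∀ (d : Dist X) a → E (atoms d) (const a) ≈ a
  E-dist-const d a = trans (E-const (atoms d) a) (trans (*-congˡ (mass d)) (*-identityʳ a))

  E-const-≤ : ∀ (d : Dist X) {h a} → Supp (λ x → h x ≤ a) (atoms d) → E (atoms d) h ≤ a
  E-const-≤ d {a = a} h≤a = ≤-trans (E-mono (nonneg d) h≤a) (≤-reflexive (E-dist-const d a))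

  E-nonneg : ∀ {l : Measure X} {h} → NonNeg l → (∀ x → 0# ≤ h x) → 0# ≤ E l h
  E-nonneg {l = l} p 0≤h = ≤-trans (≤-reflexive (sym (trans (E-const l 0#) (zeroˡ _)))) (E-mono′ p 0≤h)

  E-++ : ∀ (l l′ : Measure X) h → E (l ++ l′) h ≈ E l h + E l′ h
  E-++ []            l′ h = sym (+-identityˡ _)
  E-++ ((w , x) ∷ l) l′ h = trans (+-congˡ (E-++ l l′ h))
    (solve 3 (λ a b c → a :+ (b :+ c) := (a :+ b) :+ c) refl (w * h x) (E l h) (E l′ h))

  scale : Carrier → Measure X → Measure X
  scale a = List.map (map₁ (a *_))

  E-scale : ∀ a (l : Measure X) h → E (scale a l) h ≈ a * E l h
  E-scale a []            h = sym (zeroʳ a)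
  E-scale a ((w , x) ∷ l) h = trans (+-congˡ (E-scale a l h))
    (solve 4 (λ a w b c → a :* w :* b :+ a :* c := a :* (w :* b :+ c)) refl a w (h x) (E l h))

  scale-nonneg : ∀ {a} {l : Measure X} → 0# ≤ a → NonNeg l → NonNeg (scale a l)
  scale-nonneg 0≤a p = All.map⁺ (All.map (*-nonneg 0≤a) p)

  scale-Supp : ∀ {P : Pred X 0ℓ} a {l} → Supp P l → Supp P (scale a l)
  scale-Supp a p = All.map⁺ p

  E-swap : ∀ (l : Measure X) (l′ : Measure Y) (h : X → Y → Carrier) →
           E l (λ x → E l′ (h x)) ≈ E l′ (λ y → E l (λ x → h x y))
  E-swap []            l′ h = sym (trans (E-const l′ 0#) (zeroˡ _))
  E-swap ((w , x) ∷ l) l′ h = trans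
    (+-cong (sym (E-*ˡ l′ w (h x))) (E-swap l l′ h))
    (sym (E-+ l′ (λ y → w * h x y) (λ y → E l (λ x → h x y))))

  push : (X → Y) → Measure X → Measure Y
  push g = List.map (map₂ g)

  E-push : ∀ (g : X → Y) l h → E (push g l) h ≈ E l (h ∘ g)
  E-push g []            h = refl
  E-push g ((w , x) ∷ l) h = +-congˡ (E-push g l h)

  product : (X → Y → Z) → Measure X → Measure Y → Measure Z
  product g []            l′ = []
  product g ((w , x) ∷ l) l′ = scale w (push (g x) l′) ++ product g l l′

  E-product : ∀ (g : X → Y → Z) l l′ h → E (product g l l′) h ≈ E l (λ x → E l′ (λ y → h (g x y)))
  E-product g []            l′ h = refl
  E-product g ((w , x) ∷ l) l′ h = trans (E-++ (scale w (push (g x) l′)) _ h)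
    (+-cong (trans (E-scale w (push (g x) l′) h) (*-congˡ (E-push (g x) l′ h))) (E-product g l l′ h))

  product-nonneg : ∀ (g : X → Y → Z) {l l′} → NonNeg l → NonNeg l′ → NonNeg (product g l l′)
  product-nonneg g []        q = []
  product-nonneg g (0≤w ∷ p) q = All.++⁺ (scale-nonneg 0≤w (All.map⁺ q)) (product-nonneg g p q)

  product-Supp : ∀ {P : Pred X 0ℓ} {Q : Pred Y 0ℓ} {R : Pred Z 0ℓ} {g : X → Y → Z} {l l′} →
    Supp P l → Supp Q l′ → (∀ {x y} → P x → Q y → R (g x y)) → Supp R (product g l l′)
  product-Supp []       q r = []
  product-Supp (px ∷ p) q r = All.++⁺ (scale-Supp _ (All.map⁺ (All.map (r px) q))) (product-Supp p q r)

  lift₂ : (X → Y → Z) → Dist X → Dist Y → Dist Z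
  lift₂ g (dist l p m) (dist l′ p′ m′) = dist (product g l l′) (product-nonneg g p p′)
    (trans (E-product g l l′ (const 1#)) (trans (E-cong l (λ _ → m′)) m))

  point : X → Dist X
  point x = dist ((1# , x) ∷ []) (0≤1 ∷ []) (solve 0 (con (+ 1) :* con (+ 1) :+ con (+ 0) := con (+ 1)) refl)

  E-point : ∀ (x : X) h → E (atoms (point x)) h ≈ h x
  E-point x h = trans (+-identityʳ _) (*-identityˡ _)

  push-dist : (X → Y) → Dist X → Dist Y
  push-dist g (dist l p m) = dist (push g l) (All.map⁺ p) (trans (E-push g l (const 1#)) m)

  mixture : ∀ {a} → 0# ≤ a → a ≤ 1# → Dist X → Dist X → Dist X
  mixture {a = a} 0≤a a≤1 (dist l p m) (dist l′ p′ m′) = dist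
    (scale a l ++ scale (1# - a) l′)
    (All.++⁺ (scale-nonneg 0≤a p) (scale-nonneg (0≤-diff a≤1) p′))
    (trans (E-++ (scale a l) _ _) (trans
      (+-cong (trans (E-scale a l _) (*-congˡ m)) (trans (E-scale (1# - a) l′ _) (*-congˡ m′)))
      (solve 1 (λ a → a :* con (+ 1) :+ (con (+ 1) :- a) :* con (+ 1) := con (+ 1)) refl a)))

  E-mixture : ∀ {a} (0≤a : 0# ≤ a) (a≤1 : a ≤ 1#) (d d′ : Dist X) h →
    E (atoms (mixture 0≤a a≤1 d d′)) h ≈ a * E (atoms d) h + (1# - a) * E (atoms d′) h
  E-mixture {a = a} _ _ (dist l _ _) (dist l′ _ _) h =
    trans (E-++ (scale a l) _ h) (+-cong (E-scale a l h) (E-scale (1# - a) l′ h))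

  normalise : (l : Measure X) → NonNeg l → 0# < total-mass l → Dist X
  normalise l p 0<m = dist (scale (total-mass l ⁻¹) l) (scale-nonneg (⁻¹-nonneg 0<m) p)
    (trans (E-scale _ l _) (trans (*-comm _ _) (⁻¹-inverseʳ _ (>-nonzero 0<m))))

  -- Multiplied out, so that bounds on the unnormalised measure transfer by cancelling the mass.
  E-normalise : ∀ (l : Measure X) p (0<m : 0# < total-mass l) h →
    total-mass l * E (atoms (normalise l p 0<m)) h ≈ E l h
  E-normalise l p 0<m h = trans (*-congˡ (E-scale _ l h)) (trans (sym (*-assoc _ _ _))
    (trans (*-congʳ (⁻¹-inverseʳ _ (>-nonzero 0<m))) (*-identityˡ _)))

-- Algorithms with finite randomness

module Algorithms (em : ExcludedMiddle 0ℓ) (ℝ : CompleteOrderedField) where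

  open Distributions em ℝ public
  open Trees

  private variable
    X : Set
    N : ℕ
    ε v : Carrier
    g : PartialFunction N

  𝟙 : Bool → Carrier
  𝟙 b = if b then 1# else 0#

  𝟙-nonneg : ∀ b → 0# ≤ 𝟙 b
  𝟙-nonneg true  = 0≤1
  𝟙-nonneg false = ≤-refl

  𝟙≤1 : ∀ b → 𝟙 b ≤ 1#
  𝟙≤1 true  = ≤-refl
  𝟙≤1 false = 0≤1

  miss : Vec Bool N → DecisionTree N → Carrier
  miss y t = 𝟙 (not (eval t y))

  cost : Vec Bool N → DecisionTree N → Carrier
  cost y t = fromℕ (queries t y)

  -- Zero false-positive probability, demanded tree by tree: in this form it passes through
  -- restriction, products and truncation without averaging.
  Sound : PartialFunction N → DecisionTree N → Set
  Sound g t = ∀ y → g y ≡ just false → eval t y ≡ false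

  -- The algorithms of the class 𝔄 whose internal randomness is finite.
  record 𝔇 {N} (ε : Carrier) (g : PartialFunction N) : Set where
    constructor alg
    field
      trees : Dist (DecisionTree N)
      sound : Supp (Sound g) (atoms trees)
      error : ∀ y → g y ≡ just true → E (atoms trees) (miss y) ≤ ε
    𝔼 : (DecisionTree N → Carrier) → Carrier
    𝔼 = E (atoms trees)
  open 𝔇 public

  𝔼-cost-nonneg : (d : 𝔇 ε g) → ∀ y → 0# ≤ 𝔼 d (cost y)
  𝔼-cost-nonneg d y = E-nonneg (nonneg (trees d)) (λ t → fromℕ-nonneg (queries t y))

  accepts : PartialFunction N → Vec Bool N → Bool
  accepts g y with g y
  ... | just true = true
  ... | _         = false

  exact : PartialFunction N → DecisionTree N
  exact g = full (accepts g)

  eval-exact : ∀ (g : PartialFunction N) y {b} → g y ≡ just b → eval (exact g) y ≡ b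
  eval-exact g y eq rewrite eval-full (accepts g) y with g y
  eval-exact g y ≡.refl | just true  = ≡.refl
  eval-exact g y ≡.refl | just false = ≡.refl

  miss-exact : ∀ (g : PartialFunction N) y → g y ≡ just true → miss y (exact g) ≈ 0#
  miss-exact g y gy rewrite eval-exact g y gy = refl

  cost-exact : ∀ (g : PartialFunction N) y → cost y (exact g) ≈ fromℕ N
  cost-exact g y rewrite queries-full (accepts g) y = refl

  exactly : 0# ≤ ε → (g : PartialFunction N) → 𝔇 ε g
  exactly 0≤ε g = alg (point (exact g)) ((λ y gy → eval-exact g y gy) ∷ [])
    (λ y gy → ≤-trans (≤-reflexive (trans (E-point (exact g) (miss y)) (miss-exact g y gy))) 0≤ε)

  -- Indices beyond the list get weight 0, so the series of the resulting algorithm are eventually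
  -- constant.
  weightAt : Measure (DecisionTree N) → ℕ → Carrier
  weightAt []            _       = 0#
  weightAt ((w , _) ∷ l) zero    = w
  weightAt (_ ∷ l)       (suc R) = weightAt l R

  treeAt : Measure (DecisionTree N) → ℕ → DecisionTree N
  treeAt []            _       = output false
  treeAt ((_ , t) ∷ l) zero    = t
  treeAt (_ ∷ l)       (suc R) = treeAt l R

  weightAt-nonneg : ∀ {l : Measure (DecisionTree N)} → NonNeg l → ∀ R → 0# ≤ weightAt l R
  weightAt-nonneg []        R       = ≤-refl
  weightAt-nonneg (0≤w ∷ p) zero    = 0≤w
  weightAt-nonneg (0≤w ∷ p) (suc R) = weightAt-nonneg p R

  treeAt-Supp : ∀ {P : Pred (DecisionTree N) 0ℓ} {l} → Supp P l → ∀ R → 0# < weightAt l R → P (treeAt l R)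
  treeAt-Supp []       R       0<0 = contradiction refl (proj₂ 0<0)
  treeAt-Supp (px ∷ p) zero    0<w = px
  treeAt-Supp (px ∷ p) (suc R) 0<w = treeAt-Supp p R 0<w

  psum-atoms : ∀ (l : Measure (DecisionTree N)) h k → length l ℕ.≤ k →
               psum (λ R → weightAt l R * h (treeAt l R)) k ≈ E l h
  psum-atoms []      h k       _          = psum-zero (λ _ → zeroˡ _) k
  psum-atoms (_ ∷ l) h (suc k) (s≤s l≤k) = +-congˡ (psum-atoms l h k l≤k)

  toRandomized : Dist (DecisionTree N) → RandomizedAlgorithm N
  toRandomized (dist l p m) = record
    { tree          = treeAt l
    ; weight        = weightAt l
    ; weight-nonneg = weightAt-nonneg p
    ; weight-total  = eventually-SumsTo (weightAt l) (length l) λ k l≤k →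
        trans (psum-cong (λ R → sym (*-identityʳ _)) k) (trans (psum-atoms l (const 1#) k l≤k) m)
    }

  toRandomized-expectation : ∀ (d : Dist (DecisionTree N)) h {e} → E (atoms d) h ≈ e →
                             Expectation (toRandomized d) h e
  toRandomized-expectation (dist l _ _) h eq =
    eventually-SumsTo (λ R → weightAt l R * h (treeAt l R)) (length l) λ k l≤k → trans (psum-atoms l h k l≤k) eq

  toRandomized-𝔄 : (d : 𝔇 ε g) → toRandomized (trees d) ∈ 𝔄 ε g
  toRandomized-𝔄 d =
    (λ y gy → toRandomized-expectation (trees d) _
      (trans (E-cong-Supp (All.map (λ s → reflexive (≡.cong 𝟙 (s y gy))) (sound d))) (E-dist-const (trees d) 0#))) ,
    (λ y gy → _ , toRandomized-expectation (trees d) _ refl , error d y gy)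

  argmax : (L : List X) (D : Pred X 0ℓ) (h : X → Carrier) →
           (∀ x → x List.∈ L → ¬ D x) ⊎ ∃[ x ] (D x × ∀ x′ → x′ List.∈ L → D x′ → h x′ ≤ h x)
  argmax []      D h = inj₁ λ _ ()
  argmax (x ∷ L) D h with em {D x} | argmax L D h
  ... | no ¬Dx | inj₁ none = inj₁ λ { _ (here ≡.refl) → ¬Dx ; x′ (there x′∈) → none x′ x′∈ }
  ... | no ¬Dx | inj₂ (z , Dz , max) =
    inj₂ (z , Dz , λ { _ (here ≡.refl) Dx → contradiction Dx ¬Dx ; x′ (there x′∈) → max x′ x′∈ })
  ... | yes Dx | inj₁ none =
    inj₂ (x , Dx , λ { _ (here ≡.refl) _ → ≤-refl ; x′ (there x′∈) Dx′ → contradiction Dx′ (none x′ x′∈) })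
  ... | yes Dx | inj₂ (z , Dz , max) with total (h x) (h z)
  ...   | inj₁ hx≤hz = inj₂ (z , Dz , λ { _ (here ≡.refl) _ → hx≤hz ; x′ (there x′∈) → max x′ x′∈ })
  ...   | inj₂ hz≤hx = inj₂ (x , Dx , λ { _ (here ≡.refl) _ → ≤-refl
                                        ; x′ (there x′∈) Dx′ → ≤-trans (max x′ x′∈ Dx′) hz≤hx })

  toRandomized-maxExpectedCost : ∀ (d : Dist (DecisionTree N)) D → ∃[ y ] D y →
    ∃[ y ] (D y × IsMaxExpectedCost (toRandomized d) D (E (atoms d) (cost y)))
  toRandomized-maxExpectedCost d D (y₀ , Dy₀) with argmax (allVecs _) D (λ y → E (atoms d) (cost y))
  ... | inj₁ none = contradiction Dy₀ (none y₀ (∈-allVecs y₀))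
  ... | inj₂ (y , Dy , max) = y , Dy ,
    (λ y′ Dy′ → _ , toRandomized-expectation d _ refl , max y′ (∈-allVecs y′) Dy′) ,
    (y , Dy , toRandomized-expectation d _ refl)

  ExpectedCosts : Carrier → PartialFunction N → Pred (Vec Bool N) 0ℓ → Pred Carrier 0ℓ
  ExpectedCosts ε g D v = ∃[ A ] (A ∈ 𝔄 ε g × IsMaxExpectedCost A D v)

  -- A mere bound v suffices: `argmax` supplies the attained maximum that membership in
  -- `ExpectedCosts` requires, and it lies below v.
  infimum≤ : ∀ {D r v} → IsInfimum (ExpectedCosts ε g D) r → ∃[ y ] D y →
             (d : 𝔇 ε g) → (∀ y → D y → 𝔼 d (cost y) ≤ v) → r ≤ v
  infimum≤ {D = D} (lower , _) nonempty d bound with toRandomized-maxExpectedCost (trees d) D nonempty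
  ... | y , Dy , isMax = ≤-trans (lower _ (toRandomized (trees d) , toRandomized-𝔄 d , isMax)) (bound y Dy)

  abstract
    infimum-exists : ∀ {D} → 0# ≤ ε → (g : PartialFunction N) → ∃[ y ] D y →
                     ∃[ r ] IsInfimum (ExpectedCosts ε g D) r
    infimum-exists {D = D} 0≤ε g nonempty = infimum _
      (let d = exactly 0≤ε g ; _ , _ , isMax = toRandomized-maxExpectedCost (trees d) D nonempty
       in _ , toRandomized (trees d) , toRandomized-𝔄 d , isMax)
      -- The empty partial sum is 0, so every cost is at least 0.
      0# λ v (A , _ , _ , y , _ , conv) → psum≤limit (λ R → weight A R * cost y (tree A R))
        (λ R → *-nonneg (weight-nonneg A R) (fromℕ-nonneg (queries (tree A R) y))) conv 0

  -- The worst case is taken over the support of the randomness and has to be attained there.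
  some-positive-weight : ∀ (l : Measure (DecisionTree N)) → NonNeg l → 0# < total-mass l →
                         ∃[ R ] 0# < weightAt l R
  some-positive-weight []            p 0<m = contradiction refl (proj₂ 0<m)
  some-positive-weight ((w , t) ∷ l) (0≤w ∷ p) 0<m with w ≤? 0#
  ... | inj₂ 0<w = 0 , 0<w
  ... | inj₁ w≤0 with some-positive-weight l p (<-≤-trans 0<m
          (≤-trans (+-monoˡ-≤ _ (≤-trans (≤-reflexive (*-identityʳ w)) w≤0)) (≤-reflexive (+-identityˡ _))))
  ...   | R , 0<wR = suc R , 0<wR

  toRandomized-maxCost : ∀ (d : Dist (DecisionTree N)) D Q → ∃[ y ] D y →
    Supp (λ t → ∀ y → queries t y ℕ.≤ Q) (atoms d) →
    ∃[ k ] (IsMaxCost (toRandomized d) D k × k ℕ.≤ Q)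
  toRandomized-maxCost (dist l p m) D Q (y₀ , Dy₀) bounded = k , ((λ y R Dy 0<w → max _
      (y , R , Dy , 0<w , ≡.refl)) , attained) , bound k attained
    where
    Attained : Pred ℕ 0ℓ
    Attained k = ∃[ y ] ∃[ R ] (D y × 0# < weightAt l R × queries (treeAt l R) y ≡ k)
    bound : ∀ k → Attained k → k ℕ.≤ Q
    bound _ (y , R , Dy , 0<w , ≡.refl) = treeAt-Supp bounded R 0<w y
    some = some-positive-weight l p (<-≤-trans 0<1 (≤-reflexive (sym m)))
    M = maximumℕ Attained (_ , y₀ , proj₁ some , Dy₀ , proj₂ some , ≡.refl) Q bound
    k = proj₁ M
    attained = proj₁ (proj₂ M)
    max = proj₂ (proj₂ M)

  IsR-≤ : ∀ {k} → IsR ε g k → ∃[ y ] domain g y → (d : 𝔇 ε g) → ∀ Q →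
          Supp (λ t → ∀ y → queries t y ℕ.≤ Q) (atoms (trees d)) → k ℕ.≤ Q
  IsR-≤ {g = g} (_ , least) nonempty d Q bounded with toRandomized-maxCost (trees d) (domain g) Q nonempty bounded
  ... | k , isMax , k≤Q = ℕ.≤-trans (least k (toRandomized (trees d) , toRandomized-𝔄 d , isMax)) k≤Q

  abstract
    IsR-exists : 0# ≤ ε → (g : PartialFunction N) → ∃[ y ] domain g y → ∃[ k ] IsR ε g k
    IsR-exists {N = N} 0≤ε g nonempty =
      let d = exactly 0≤ε g
          _ , isMax , _ = toRandomized-maxCost (trees d) (domain g) N nonempty
                            ((λ y → ℕ.≤-reflexive (queries-full (accepts g) y)) ∷ [])
      in minimumℕ _ _ (toRandomized (trees d) , toRandomized-𝔄 d , isMax)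

  -- From countable to finite randomness

  -- A common consequence of bounds on the expected and on the worst-case cost, so that one lower
  -- bound serves both measures.
  PartialCostsBounded : RandomizedAlgorithm N → Pred (Vec Bool N) 0ℓ → Carrier → Set
  PartialCostsBounded A D v =
    ∀ y → D y → ∀ k → psum (λ R → weight A R * cost y (tree A R)) k ≤ v

  maxExpectedCost⇒bounded : ∀ (A : RandomizedAlgorithm N) {D v} → IsMaxExpectedCost A D v → PartialCostsBounded A D v
  maxExpectedCost⇒bounded A (upper , _) y Dy k with upper y Dy
  ... | e , conv , e≤v = ≤-trans
    (psum≤limit (λ R → weight A R * cost y (tree A R))
      (λ R → *-nonneg (weight-nonneg A R) (fromℕ-nonneg (queries (tree A R) y))) conv k) e≤v

  maxCost⇒bounded : ∀ (A : RandomizedAlgorithm N) {D k} → IsMaxCost A D k → PartialCostsBounded A D (fromℕ k)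
  maxCost⇒bounded A {k = k} (upper , _) y Dy j = begin
    psum (λ R → weight A R * cost y (tree A R)) j   ≤⟨ psum-≤ term≤ j ⟩
    psum (λ R → weight A R * fromℕ k) j             ≈⟨ psum-*ʳ (weight A) (fromℕ k) j ⟩
    psum (weight A) j * fromℕ k
        ≤⟨ *-monoˡ-≤ (fromℕ-nonneg k) (psum≤limit (weight A) (weight-nonneg A) (weight-total A) j) ⟩
    1# * fromℕ k                                    ≈⟨ *-identityˡ _ ⟩
    fromℕ k                                         ∎
    where
    open ≤-Reasoning
    term≤ : ∀ R → weight A R * cost y (tree A R) ≤ weight A R * fromℕ k
    -- The worst case ignores trees of weight 0; they may be deeper than k but contribute nothing.
    term≤ R with weight A R ≤? 0#
    ... | inj₂ 0<w = *-monoʳ-≤ (weight-nonneg A R) (fromℕ-mono (upper y R Dy 0<w))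
    ... | inj₁ w≤0 = ≤-reflexive (trans (w≈0* _) (sym (w≈0* _)))
      where w≈0* : ∀ b → weight A R * b ≈ 0#
            w≈0* b = trans (*-congʳ (≤-antisym w≤0 (weight-nonneg A R))) (zeroˡ b)

  prefix : (ℕ → Carrier) → (ℕ → X) → ℕ → Measure X
  prefix w t zero    = []
  prefix w t (suc k) = (w 0 , t 0) ∷ prefix (w ∘ suc) (t ∘ suc) k

  E-prefix : ∀ (w : ℕ → Carrier) (t : ℕ → X) h k → E (prefix w t k) h ≈ psum (λ R → w R * h (t R)) k
  E-prefix w t h zero    = refl
  E-prefix w t h (suc k) = +-congˡ (E-prefix (w ∘ suc) (t ∘ suc) h k)

  prefix-All : ∀ {P : Pred (Carrier × X) 0ℓ} {w : ℕ → Carrier} {t : ℕ → X} → (∀ R → P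
      (w R , t R)) → ∀ k → All P (prefix w t k)
  prefix-All p zero    = []
  prefix-All p (suc k) = p 0 ∷ prefix-All (p ∘ suc) k

  module Prefix (A : RandomizedAlgorithm N) (A∈𝔄 : A ∈ 𝔄 ε g) (K : ℕ) where
    open ≤-Reasoning

    mass-kept mass-moved : Carrier
    mass-kept  = psum (weight A) K
    mass-moved = 1# - mass-kept

    mass-moved-nonneg : 0# ≤ mass-moved
    mass-moved-nonneg = 0≤-diff (psum≤limit (weight A) (weight-nonneg A) (weight-total A) K)

    -- A tree of weight 0 need not be sound.
    replace : ∀ R → weight A R ≤ 0# ⊎ 0# < weight A R → DecisionTree N
    replace R (inj₁ _) = exact g
    replace R (inj₂ _) = tree A R

    keep : ℕ → DecisionTree N
    keep R = replace R (weight A R ≤? 0#)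

    E-replace : ∀ (h : DecisionTree N → Carrier) R c → weight A R * h (replace R c) ≈ weight A R * h (tree A R)
    E-replace h R (inj₂ _)   = refl
    E-replace h R (inj₁ w≤0) = trans (vanishes _) (sym (vanishes _))
      where
      vanishes : ∀ b → weight A R * b ≈ 0#
      vanishes b = trans (*-congʳ (≤-antisym w≤0 (weight-nonneg A R))) (zeroˡ b)

    -- A tree of positive weight that accepts a zero would by itself raise the false-positive
    -- probability to at least its weight.
    replace-sound : ∀ R c → Sound g (replace R c)
    replace-sound R (inj₁ _)   y gy = eval-exact g y gy
    replace-sound R (inj₂ 0<w) y gy with eval (tree A R) y in eq
    ... | false = ≡.refl
    ... | true  = contradiction (begin
      weight A R                             ≈⟨ *-identityʳ _ ⟨
      weight A R * 1#                        ≡⟨ ≡.cong (λ b → weight A R * 𝟙 b) eq ⟨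
      weight A R * 𝟙 (eval (tree A R) y)
        ≤⟨ term≤limit (λ R → weight A R * 𝟙 (eval (tree A R) y)) (λ R → *-nonneg (weight-nonneg A R) (𝟙-nonneg
            (eval (tree A R) y))) (proj₁ A∈𝔄 y gy) R ⟩
      0#                                     ∎) (<⇒≱ 0<w)

    -- `exact g` is sound and never misses, so handing it the mass of the tail keeps the error
    -- within ε itself; the price is N queries per unit of moved mass.
    kept : Measure (DecisionTree N)
    kept = (mass-moved , exact g) ∷ prefix (weight A) keep K

    E-kept : ∀ h → E kept h ≈ mass-moved * h (exact g) + psum (λ R → weight A R * h (tree A R)) K
    E-kept h = +-congˡ (trans (E-prefix (weight A) keep h K) (psum-cong (λ R → E-replace h R (weight A R ≤? 0#)) K))

    kept-mass : total-mass kept ≈ 1#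
    kept-mass = trans (E-kept (const 1#)) (trans (+-congˡ (psum-cong (λ R → *-identityʳ _) K))
      (solve 1 (λ p → (con (+ 1) :- p) :* con (+ 1) :+ p := con (+ 1)) refl mass-kept))

    kept-error : ∀ y → g y ≡ just true → E kept (miss y) ≤ ε
    kept-error y gy with proj₂ A∈𝔄 y gy
    ... | q , conv , q≤ε = begin
      E kept (miss y)                                  ≈⟨ E-kept (miss y) ⟩
      mass-moved * miss y (exact g) + missed
          ≈⟨ +-congʳ (trans (*-congˡ (miss-exact g y gy)) (zeroʳ mass-moved)) ⟩
      0# + missed                                      ≈⟨ +-identityˡ _ ⟩
      missed
        ≤⟨ psum≤limit (λ R → weight A R * miss y (tree A R)) (λ R → *-nonneg (weight-nonneg A R) (𝟙-nonneg
            (not (eval (tree A R) y)))) conv K ⟩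
      q                                                ≤⟨ q≤ε ⟩
      ε                                                ∎
      where missed = psum (λ R → weight A R * miss y (tree A R)) K

    kept-algorithm : 𝔇 ε g
    kept-algorithm = alg
      (dist kept (mass-moved-nonneg ∷ prefix-All (weight-nonneg A) K) kept-mass)
      ((λ y gy → eval-exact g y gy) ∷ prefix-All (λ R → replace-sound R (weight A R ≤? 0#)) K)
      kept-error

    mass-moved-≤ : ∀ {η} → 1# - η ≤ mass-kept → mass-moved ≤ η
    mass-moved-≤ {η} le = 0≤-diff⁻¹ (0≤-diff le)
      (solve 2 (λ η p → p :- (con (+ 1) :- η) := η :- (con (+ 1) :- p)) refl η mass-kept)

    kept-cost-≤ : ∀ {η v} y → mass-moved ≤ η → psum (λ R → weight A R * cost y (tree A R)) K ≤ v →
                  𝔼 kept-algorithm (cost y) ≤ v + fromℕ N * η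
    kept-cost-≤ {η} {v} y moved≤η bounded = begin
      E kept (cost y)                              ≈⟨ E-kept (cost y) ⟩
      mass-moved * cost y (exact g) + paid         ≈⟨ +-congʳ (*-congˡ (cost-exact g y)) ⟩
      mass-moved * fromℕ N + paid                  ≤⟨ +-mono-≤ (*-monoˡ-≤ (fromℕ-nonneg N) moved≤η) bounded ⟩
      η * fromℕ N + v
          ≈⟨ solve 3 (λ η N v → η :* N :+ v := v :+ N :* η) refl η (fromℕ N) v ⟩
      v + fromℕ N * η                              ∎
      where paid = psum (λ R → weight A R * cost y (tree A R)) K

  finite-approximation : (A : RandomizedAlgorithm N) → A ∈ 𝔄 ε g → ∀ {D v} → PartialCostsBounded A D v →
    ∀ δ → 0# < δ → ∃[ d ] (∀ y → D y → 𝔼 {ε = ε} {g} d (cost y) ≤ v + δ)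
  finite-approximation {N = N} A A∈𝔄 bounded δ 0<δ =
    let η , 0<η , Nη≤δ = small-multiple N 0<δ
        K , 1-η≤p      = psum-close (weight A) (weight-total A) 0<η
        open Prefix A A∈𝔄 K
    in kept-algorithm , λ y Dy →
         ≤-trans (kept-cost-≤ y (mass-moved-≤ 1-η≤p) (bounded y Dy K)) (+-monoʳ-≤ _ Nη≤δ)

-- Hard distributions on the zeros

module Minimax (em : ExcludedMiddle 0ℓ) (ℝ : CompleteOrderedField) where

  open import Data.List.Base using (_++_)
  open Algorithms em ℝ
  open Trees

  private variable
    N : ℕ

  domain-just : ∀ (g : PartialFunction N) {y b} → g y ≡ just b → domain g y
  domain-just g gy rewrite gy = any-just tt

  DepthAtMost : ℕ → Measure (DecisionTree N) → Set
  DepthAtMost W = Supp (λ t → depth t ℕ.≤ W)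

  depth-bound : (l : Measure (DecisionTree N)) → ∃[ W ] DepthAtMost W l
  depth-bound []            = 0 , []
  depth-bound ((_ , t) ∷ l) =
    let W , bounded = depth-bound l
    in depth t ℕ.⊔ W , ℕ.m≤m⊔n (depth t) W ∷ All.map (λ t≤W → ℕ.≤-trans t≤W (ℕ.m≤n⊔m (depth t) W)) bounded

  𝔼-cost≤depth : ∀ {ε W} {g : PartialFunction N} (d : 𝔇 ε g) → DepthAtMost W (atoms (trees d)) →
                 ∀ x → 𝔼 d (cost x) ≤ fromℕ W
  𝔼-cost≤depth d shallow x = E-const-≤ (trees d)
    (All.map (λ {(_ , t)} t≤W → fromℕ-mono (ℕ.≤-trans (queries≤depth t x) t≤W)) shallow)

  reweight : {X : Set} → (X → Carrier) → Measure X → Measure X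
  reweight p = List.map (λ (w , x) → w * p x , x)

  E-reweight : ∀ {X : Set} p (l : Measure X) h → E (reweight p l) h ≈ E l (λ x → p x * h x)
  E-reweight p []            h = refl
  E-reweight p ((w , x) ∷ l) h = +-cong (*-assoc w (p x) (h x)) (E-reweight p l h)

  module Counting (f : PartialFunction N) where

    zerosIn : List (Vec Bool N) → Measure (Vec Bool N)
    zerosIn []      = []
    zerosIn (x ∷ L) with f x
    ... | just false = (1# , x) ∷ zerosIn L
    ... | just true  = zerosIn L
    ... | nothing    = zerosIn L

    zerosIn-nonneg : ∀ L → NonNeg (zerosIn L)
    zerosIn-nonneg []      = []
    zerosIn-nonneg (x ∷ L) with f x
    ... | just false = 0≤1 ∷ zerosIn-nonneg L
    ... | just true  = zerosIn-nonneg L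
    ... | nothing    = zerosIn-nonneg L

    zerosIn-Supp : ∀ L → Supp (zeros f) (zerosIn L)
    zerosIn-Supp []      = []
    zerosIn-Supp (x ∷ L) with f x in fx
    ... | just false = fx ∷ zerosIn-Supp L
    ... | just true  = zerosIn-Supp L
    ... | nothing    = zerosIn-Supp L

    ≤E-zerosIn : ∀ {h : Vec Bool N → Carrier} → (∀ x → 0# ≤ h x) →
                 ∀ L {x} → x List.∈ L → zeros f x → h x ≤ E (zerosIn L) h
    ≤E-zerosIn {h} 0≤h (x ∷ L) (here ≡.refl) fx rewrite fx =
      ≤-trans (≤-reflexive (sym (*-identityˡ (h x)))) (x≤x+y (E-nonneg (zerosIn-nonneg L) 0≤h))
    ≤E-zerosIn {h} 0≤h (x ∷ L) (there x′∈L) fx′ with f x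
    ... | just false = ≤-trans (≤E-zerosIn 0≤h L x′∈L fx′)
      (≤-trans (≤-reflexive (sym (+-identityˡ _))) (+-monoˡ-≤ _ (*-nonneg 0≤1 (0≤h x))))
    ... | just true  = ≤E-zerosIn 0≤h L x′∈L fx′
    ... | nothing    = ≤E-zerosIn 0≤h L x′∈L fx′

    -- The counting measure on the zeros. For a nonnegative integrand its integral dominates the
    -- value at each zero, which turns a bound on the total potential into a bound at every zero.
    κ : Measure (Vec Bool N)
    κ = zerosIn (allVecs N)

    κ-nonneg : NonNeg κ
    κ-nonneg = zerosIn-nonneg (allVecs N)

    κ-zeros : Supp (zeros f) κ
    κ-zeros = zerosIn-Supp (allVecs N)

    ≤E-κ : ∀ {h : Vec Bool N → Carrier} → (∀ x → 0# ≤ h x) → ∀ {x} → zeros f x → h x ≤ E κ h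
    ≤E-κ 0≤h = ≤E-zerosIn 0≤h (allVecs N) (∈-allVecs _)

  -- From (u - b)² + (u + b)² = 2u² + 2b² with u ≤ W. This form is indifferent to the sign of b,
  -- which matters as b = c - δ may be negative.
  deviation-bound : ℕ → Carrier → Carrier
  deviation-bound W b = (1# + 1#) * (fromℕ W * fromℕ W) + (1# + 1#) * (b * b)

  squared-deviation : ∀ W b {u} → 0# ≤ u → u ≤ fromℕ W → (u - b) * (u - b) ≤ deviation-bound W b
  squared-deviation W b {u} 0≤u u≤W = begin
    (u - b) * (u - b)                      ≤⟨ x≤x+y (square-nonneg (u + b)) ⟩
    (u - b) * (u - b) + (u + b) * (u + b)
      ≈⟨ solve 2 (λ u b → (u :- b) :* (u :- b) :+ (u :+ b) :* (u :+ b) :=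
                          (con (+ 1) :+ con (+ 1)) :* (u :* u) :+ (con (+ 1) :+ con (+ 1)) :* (b :* b)) refl u b ⟩
    (1# + 1#) * (u * u) + (1# + 1#) * (b * b)
      ≤⟨ +-monoˡ-≤ _ (*-monoʳ-≤ (+-nonneg 0≤1 0≤1) (*-mono-≤ 0≤u u≤W 0≤u u≤W)) ⟩
    deviation-bound W b ∎
    where open ≤-Reasoning

  -- Blackwell's approachability: if every distribution μ on the zeros admitted a response
  -- of expected cost below b, then repeatedly playing μ ∝ (excess of the
  -- accumulated cost over b)⁺ and adding the response would keep the squared
  -- excess linear in the number T of rounds, so that the average of the
  -- responses would cost at most b + O(1/√T) on every zero.
  module Approach {N : ℕ} {ε : Carrier} {f : PartialFunction N} (W : ℕ) (b : Carrier)
    {x₀ : Vec Bool N} (fx₀ : f x₀ ≡ just false)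
    (response : (μ : Dist (Vec Bool N)) → Supp (zeros f) (atoms μ) →
                ∃[ d ] (DepthAtMost W (atoms (trees {ε = ε} {f} d)) ×
                        E (atoms μ) (λ x → 𝔼 d (cost x)) ≤ b))
    where
    open Counting f
    open ≤-Reasoning

    2# B M : Carrier
    2# = 1# + 1#
    B = deviation-bound W b
    M = E κ (const B)

    -- The responses of T rounds are added without normalising, so that all invariants are additive;
    -- a single division at the end gives the average.
    record Accumulated (T : ℕ) : Set where
      field
        sum-of-responses : Measure (DecisionTree N)
        sum-nonneg : NonNeg sum-of-responses
        sum-mass   : total-mass sum-of-responses ≈ fromℕ T
        sum-sound  : Supp (Sound f) sum-of-responses
        sum-error  : ∀ x → f x ≡ just true → E sum-of-responses (miss x) ≤ fromℕ T * ε
      excess : Vec Bool N → Carrier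
      excess x = E sum-of-responses (cost x) - fromℕ T * b
      field
        potential : E κ (λ x → excess x ⁺²) ≤ fromℕ T * M
    open Accumulated

    -- With p the positive excess, the sum of p times (cost - b) is, up to the factor 2, the linear
    -- term in the growth of the potential; answering the distribution proportional to p makes it
    -- nonpositive.
    respond : (p : Vec Bool N → Carrier) → (∀ x → 0# ≤ p x) →
      ∃[ d ] (DepthAtMost W (atoms (trees d)) × E κ (λ x → p x * (𝔼 d (cost x) - b)) ≤ 0#)
    respond p 0≤p with E κ p ≤? 0#
    -- Without mass, p vanishes on every zero and any algorithm of bounded depth will do; the
    -- response to the point mass at x₀ is one.
    ... | inj₁ P≤0 =
      let d , shallow , _ = response (point x₀) (fx₀ ∷ [])
      in d , shallow , ≤-reflexive (trans
           (E-cong-Supp (All.map (λ fx → trans (*-congʳ (≤-antisym (≤-trans (≤E-κ 0≤p fx) P≤0) (0≤p _)))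
               (zeroˡ _)) κ-zeros))
           (trans (E-const κ 0#) (zeroˡ _)))
    ... | inj₂ 0<P =
      let d , shallow , cheap = response μ (All.map⁺ (All.map⁺ κ-zeros))
          avg = E (atoms μ) (λ x → 𝔼 d (cost x))
          P = total-mass ν
      in d , shallow , (begin
        E κ (λ x → p x * (𝔼 d (cost x) - b))       ≈⟨ E-reweight p κ _ ⟨
        E ν (λ x → 𝔼 d (cost x) - b)               ≈⟨ E-+ ν _ _ ⟩
        E ν (λ x → 𝔼 d (cost x)) + E ν (const (- b))
            ≈⟨ +-cong (sym (E-normalise ν ν-nonneg 0<ν _)) (E-const ν (- b)) ⟩
        P * avg + - b * P                          ≤⟨ +-monoˡ-≤ _ (*-monoʳ-≤ (proj₁ 0<ν) cheap) ⟩
        P * b + - b * P                            ≈⟨ solve 2 (λ P b → P :* b :+ (:- b) :* P := con (+ 0)) refl P b ⟩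
        0#                                         ∎)
      where
      ν = reweight p κ
      ν-nonneg : NonNeg ν
      ν-nonneg = All.map⁺ (All.map (λ {(_ , x)} 0≤w → *-nonneg 0≤w (0≤p x)) κ-nonneg)
      0<ν : 0# < total-mass ν
      0<ν = <-≤-trans 0<P (≤-reflexive (sym (trans (E-reweight p κ _) (E-cong κ (λ x → *-identityʳ (p x))))))
      μ = normalise ν ν-nonneg 0<ν

    accumulate : ∀ T → Accumulated T
    accumulate zero = record
      { sum-of-responses = [] ; sum-nonneg = [] ; sum-mass = refl ; sum-sound = []
      ; sum-error = λ _ _ → ≤-reflexive (sym (zeroˡ ε))
      ; potential = ≤-reflexive (trans (E-cong κ no-excess) (trans (E-const κ 0#) (trans (zeroˡ _) (sym (zeroˡ M)))))
      }
      where
      no-excess : ∀ x → (0# - 0# * b) ⁺² ≈ 0#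
      no-excess x = ≤-antisym
        (≤-trans (*-mono-≤ (⁺-nonneg _) le (⁺-nonneg _) le) (≤-reflexive (zeroˡ 0#)))
        (*-nonneg (⁺-nonneg _) (⁺-nonneg _))
        where le = ⁺-least (≤-reflexive (solve 1 (λ b → con (+ 0) :- con (+ 0) :* b := con (+ 0)) refl b)) ≤-refl
    accumulate (suc T) = record
      { sum-of-responses = l ++ atoms (trees d)
      ; sum-nonneg = All.++⁺ (sum-nonneg acc) (nonneg (trees d))
      ; sum-mass = trans (E-++ l _ _) (trans (+-cong (sum-mass acc) (mass (trees d))) (+-comm _ _))
      ; sum-sound = All.++⁺ (sum-sound acc) (sound d)
      ; sum-error = λ x fx → begin
          E (l ++ atoms (trees d)) (miss x)     ≈⟨ E-++ l _ _ ⟩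
          E l (miss x) + 𝔼 d (miss x)           ≤⟨ +-mono-≤ (sum-error acc x fx) (error d x fx) ⟩
          fromℕ T * ε + ε
              ≈⟨ solve 2 (λ t ε → t :* ε :+ ε := (con (+ 1) :+ t) :* ε) refl (fromℕ T) ε ⟩
          fromℕ (suc T) * ε                     ∎
      ; potential = begin
          E κ (λ x → (E (l ++ atoms (trees d)) (cost x) - fromℕ (suc T) * b) ⁺²)
            ≤⟨ E-mono κ-nonneg (All.universal (λ (_ , x) → step x) κ) ⟩
          E κ (λ x → (a x ⁺² + 2# * (a x ⁺ * g x)) + B)
            ≈⟨ trans (E-+ κ _ _) (+-congʳ (trans (E-+ κ _ _) (+-congˡ (E-*ˡ κ 2# _)))) ⟩
          (E κ (λ x → a x ⁺²) + 2# * E κ (λ x → a x ⁺ * g x)) + M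
            -- The choice of weights makes the linear term nonpositive; only the quadratic term, at
            -- most M, is added in this round.
            ≤⟨ +-monoˡ-≤ M (+-mono-≤ (potential acc) (*-monoʳ-≤ (+-nonneg 0≤1 0≤1) no-gain)) ⟩
          (fromℕ T * M + 2# * 0#) + M
            ≈⟨ solve 2 (λ t M → (t :* M :+ con (+ 2) :* con (+ 0)) :+ M := (con (+ 1) :+ t) :* M) refl (fromℕ T) M ⟩
          fromℕ (suc T) * M ∎
      }
      where
      acc = accumulate T
      l = sum-of-responses acc
      a : Vec Bool N → Carrier
      a = excess acc
      answer = respond (λ x → a x ⁺) (λ x → ⁺-nonneg (a x))
      d = proj₁ answer
      shallow = proj₁ (proj₂ answer)
      no-gain = proj₂ (proj₂ answer)
      g : Vec Bool N → Carrier
      g x = 𝔼 d (cost x) - b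
      step : ∀ x → (E (l ++ atoms (trees d)) (cost x) - fromℕ (suc T) * b) ⁺² ≤ (a x ⁺² + 2# * (a x ⁺ * g x)) + B
      step x = begin
        (E (l ++ atoms (trees d)) (cost x) - fromℕ (suc T) * b) ⁺²
          ≤⟨ ⁺²-mono (≤-reflexive (trans (+-congʳ (E-++ l _ _))
               (solve 4 (λ s e t b → s :+ e :- (con (+ 1) :+ t) :* b := (s :- t :* b) :+ (e :- b)) refl
                 (E l (cost x)) (𝔼 d (cost x)) (fromℕ T) b))) ⟩
        (a x + g x) ⁺²                             ≤⟨ ⁺²-+ (a x) (g x) ⟩
        a x ⁺² + 2# * (a x ⁺ * g x) + g x * g x
          ≤⟨ +-monoʳ-≤ _ (squared-deviation W b (𝔼-cost-nonneg d x) (𝔼-cost≤depth d shallow x)) ⟩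
        a x ⁺² + 2# * (a x ⁺ * g x) + B            ∎

    -- After T rounds the squared positive excess at each zero is at most T M, so an excess above T
    -- η would force T η² ≤ M.
    average : ∀ η → 0# < η → ∃[ d ] (∀ x → zeros f x → 𝔼 {ε = ε} {f} d (cost x) ≤ b + η)
    average η 0<η = d , λ x fx → *-cancelˡ-≤ 0<mass (begin
        total-mass l * 𝔼 d (cost x)       ≈⟨ E-normalise l (sum-nonneg acc) 0<mass (cost x) ⟩
        E l (cost x)                      ≤⟨ 0≤-diff⁻¹ (0≤-diff (excess≤ x fx))
          (solve 4 (λ t η e b → t :* η :- (e :- t :* b) := t :* (b :+ η) :- e) refl rounds η (E l (cost x)) b) ⟩
        rounds * (b + η)                       ≈⟨ *-congʳ (sum-mass acc) ⟨
        total-mass l * (b + η)            ∎)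
      where
      -- This n has M ≤ n η²; one further round makes the inequality strict and the mass positive.
      η²-multiple = archimedean-* M (*-pos 0<η 0<η)
      n = proj₁ η²-multiple
      acc = accumulate (suc n)
      l = sum-of-responses acc
      rounds = fromℕ (suc n)
      0<mass : 0# < total-mass l
      0<mass = <-≤-trans (0<suc n) (≤-reflexive (sym (sum-mass acc)))
      M<rounds·η² : M < rounds * (η * η)
      M<rounds·η² = ≤-<-trans (proj₂ η²-multiple) (<-≤-trans (+-pos-< (*-pos 0<η 0<η))
        (≤-reflexive (solve 2 (λ n e → n :* e :+ e := (con (+ 1) :+ n) :* e) refl (fromℕ n) (η * η))))
      excess≤ : ∀ x → zeros f x → excess acc x ≤ rounds * η
      excess≤ x fx = ≤-by-contradiction λ rounds·η<e → <⇒≱ M<rounds·η² (*-cancelˡ-≤ (0<suc n) (begin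
        rounds * (rounds * (η * η))
            ≈⟨ solve 2 (λ t η → t :* (t :* (η :* η)) := (t :* η) :* (t :* η)) refl rounds η ⟩
        (rounds * η) * (rounds * η)
            ≤⟨ square≤⁺² (*-nonneg (fromℕ-nonneg (suc n)) (proj₁ 0<η)) (proj₁ rounds·η<e) ⟩
        excess acc x ⁺²
            ≤⟨ ≤E-κ {h = λ x → excess acc x ⁺²} (λ x → *-nonneg (⁺-nonneg _) (⁺-nonneg _)) fx ⟩
        E κ (λ x → excess acc x ⁺²)       ≤⟨ potential acc ⟩
        rounds * M                             ∎))
      d : 𝔇 ε f
      d = alg (normalise l (sum-nonneg acc) 0<mass) (scale-Supp _ (sum-sound acc)) λ x fx →
        *-cancelˡ-≤ 0<mass (begin
          total-mass l * E (atoms (normalise l (sum-nonneg acc) 0<mass)) (miss x)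
                                          ≈⟨ E-normalise l (sum-nonneg acc) 0<mass (miss x) ⟩
          E l (miss x)                    ≤⟨ sum-error acc x fx ⟩
          rounds * ε                           ≈⟨ *-congʳ (sum-mass acc) ⟨
          total-mass l * ε                ∎)

  Hard : ∀ {N} → Carrier → PartialFunction N → ℕ → Carrier → Dist (Vec Bool N) → Set
  Hard ε f W b μ = (d : 𝔇 ε f) → DepthAtMost W (atoms (trees d)) → b ≤ E (atoms μ) (λ x → 𝔼 d (cost x))

  -- If no μ were hard, each would have a response of cost at most c - δ, and averaging responses
  -- would give an algorithm of cost at most c - δ + η < c on all zeros, below the infimum.
  minimax : ∀ {ε c} {f : PartialFunction N} → IsSingleCopyCost ε f c → ∀ {x₀} → f x₀ ≡ just false →
            ∀ W δ → 0# < δ → ∃[ μ ] (Supp (zeros f) (atoms μ) × Hard ε f W (c - δ) μ)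
  minimax {ε = ε} {c} {f} isCost fx₀ W δ 0<δ with em {∃[ μ ] (Supp (zeros f) (atoms μ) × Hard ε f W (c - δ) μ)}
  ... | yes p = p
  ... | no ¬p =
    let η , 0<η , 2η≤δ = small-multiple 2 0<δ
        d , cheap = Approach.average W (c - δ) fx₀ response η 0<η
        c≤c-δ+η = infimum≤ isCost (_ , fx₀) d cheap
    in ⊥-elim (<⇒≱ 0<η (0≤-diff⁻¹ (+-nonneg (+-nonneg (0≤-diff c≤c-δ+η) (0≤-diff 2η≤δ)) ≤-refl)
      (solve 3 (λ c δ η → c :- δ :+ η :- c :+ (δ :- (con (+ 1) :+ (con (+ 1) :+ con (+ 0))) :* η) :+ con
          (+ 0) := con (+ 0) :- η) refl c δ η)))
    where
    response : ∀ μ → Supp (zeros f) (atoms μ) →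
      ∃[ d ] (DepthAtMost W (atoms (trees {ε = ε} {f} d)) × E (atoms μ) (λ x → 𝔼 d (cost x)) ≤ c - δ)
    response μ μ-zeros with em {∃[ d ] (DepthAtMost W (atoms (trees {ε = ε} {f} d)) × E (atoms μ) (λ x → 𝔼 d
        (cost x)) ≤ c - δ)}
    ... | yes r = r
    ... | no ¬r = ⊥-elim (¬p (μ , μ-zeros , λ d shallow →
      ≤-by-contradiction λ cheap → ¬r (d , shallow , proj₁ cheap)))

-- The lower bound: additivity of the cost over blocks

module DirectSum (em : ExcludedMiddle 0ℓ) (ℝ : CompleteOrderedField) where

  open Algorithms em ℝ
  open Minimax em ℝ
  open Trees

  private variable
    n m W : ℕ
    ε b : Carrier

  power : ∀ n → Dist (Vec Bool m) → Dist (Vec Bool (n ℕ.* m))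
  power zero    μ = point Vec.[]
  power (suc n) μ = lift₂ Vec._++_ μ (power n μ)

  power-zeros : ∀ n (f : PartialFunction m) {μ} → Supp (zeros f) (atoms μ) →
                Supp (zeros (OR n ∘ f)) (atoms (power n μ))
  power-zeros zero    f μ-zeros = ≡.refl ∷ []
  power-zeros (suc n) f μ-zeros = product-Supp μ-zeros (power-zeros n f μ-zeros) (zero-OR-++ n f)

  OR-++-true : ∀ n (f : PartialFunction m) {x z p q} → f x ≡ just p → (OR n ∘ f) z ≡ just q → p ∨ q ≡ true →
               (OR suc n ∘ f) (x Vec.++ z) ≡ just true
  OR-++-true n f {x} {z} fx fz pq =
    ≡.trans (OR-++ n f x z) (≡.trans (≡.cong₂ (Maybe.zipWith _∨_) fx fz) (≡.cong just pq))

  module _ {m : ℕ} (n : ℕ) (f : PartialFunction m) (d : 𝔇 ε (OR suc n ∘ f)) where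
    open ≤-Reasoning

    miss-fixʳ : ∀ (x : Vec Bool m) (z : Vec Bool (n ℕ.* m)) t → miss x (fixʳ z t) ≈ miss (x Vec.++ z) t
    miss-fixʳ x z t = reflexive (≡.cong (𝟙 ∘ not) (eval-fixʳ t x z))

    miss-fixˡ : ∀ (x : Vec Bool m) (z : Vec Bool (n ℕ.* m)) t → miss z (fixˡ x t) ≈ miss (x Vec.++ z) t
    miss-fixˡ x z t = reflexive (≡.cong (𝟙 ∘ not) (eval-fixˡ t x z))

    -- The draw from ζ becomes internal randomness. For each fixed z of value 0 the OR equals f x,
    -- so the error is at most ε for every z and hence on average.
    first-block : (ζ : Dist (Vec Bool (n ℕ.* m))) → Supp (zeros (OR n ∘ f)) (atoms ζ) → 𝔇 ε f
    first-block ζ ζ-zeros = alg (lift₂ fixʳ ζ (trees d))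
      (product-Supp ζ-zeros (sound d) λ {z} {t} fz sound-t x fx →
        ≡.trans (eval-fixʳ t x z) (sound-t _ (zero-OR-++ n f fx fz)))
      λ x fx → begin
        E (atoms (lift₂ fixʳ ζ (trees d))) (miss x)   ≈⟨ E-product fixʳ (atoms ζ) _ _ ⟩
        E (atoms ζ) (λ z → 𝔼 d (λ t → miss x (fixʳ z t)))
          ≤⟨ E-const-≤ ζ (All.map (λ {(_ , z)} fz → ≤-trans
               (≤-reflexive (E-cong (atoms (trees d)) (miss-fixʳ x z)))
               (error d _ (OR-++-true n f fx fz ≡.refl))) ζ-zeros) ⟩
        ε                                             ∎

    other-blocks : (μ : Dist (Vec Bool m)) → Supp (zeros f) (atoms μ) → 𝔇 ε (OR n ∘ f)
    other-blocks μ μ-zeros = alg (lift₂ fixˡ μ (trees d))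
      (product-Supp μ-zeros (sound d) λ {x} {t} fx sound-t z fz →
        ≡.trans (eval-fixˡ t x z) (sound-t _ (zero-OR-++ n f fx fz)))
      λ z fz → begin
        E (atoms (lift₂ fixˡ μ (trees d))) (miss z)   ≈⟨ E-product fixˡ (atoms μ) _ _ ⟩
        E (atoms μ) (λ x → 𝔼 d (λ t → miss z (fixˡ x t)))
          ≤⟨ E-const-≤ μ (All.map (λ {(_ , x)} fx → ≤-trans
               (≤-reflexive (E-cong (atoms (trees d)) (miss-fixˡ x z)))
               (error d _ (OR-++-true n f fx fz ≡.refl))) μ-zeros) ⟩
        ε                                             ∎

    -- In both terms the pair (x , z) has law μ × ζ; they differ only in which half is the input and
    -- which is internal randomness. After exchanging the sums, the costs add up tree by tree.
    block-costs : ∀ μ μ-zeros ζ ζ-zeros →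
      E (atoms μ) (λ x → 𝔼 (first-block ζ ζ-zeros) (cost x)) +
      E (atoms ζ) (λ z → 𝔼 (other-blocks μ μ-zeros) (cost z)) ≈
      E (atoms (lift₂ Vec._++_ μ ζ)) (λ y → 𝔼 d (cost y))
    block-costs (dist μ _ _) μ-zeros (dist ζ _ _) ζ-zeros = begin-equality
      E μ (λ x → E (product fixʳ ζ D) (cost x)) + E ζ (λ z → E (product fixˡ μ D) (cost z))
        ≈⟨ +-cong (E-cong μ (λ x → E-product fixʳ ζ D (cost x))) (E-cong ζ (λ z → E-product fixˡ μ D (cost z))) ⟩
      E μ (λ x → E ζ (λ z → E D (λ t → cost x (fixʳ z t)))) + E ζ (λ z → E μ (λ x → E D (λ t → cost z (fixˡ x t))))
        ≈⟨ +-congˡ (E-swap ζ μ _) ⟩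
      E μ (λ x → E ζ (λ z → E D (λ t → cost x (fixʳ z t)))) + E μ (λ x → E ζ (λ z → E D (λ t → cost z (fixˡ x t))))
        ≈⟨ E-+ μ _ _ ⟨
      E μ (λ x → E ζ (λ z → E D (λ t → cost x (fixʳ z t))) + E ζ (λ z → E D (λ t → cost z (fixˡ x t))))
        ≈⟨ E-cong μ (λ x → trans (sym (E-+ ζ _ _)) (E-cong ζ (λ z → trans (sym (E-+ D _ _)) (E-cong D
            (split x z))))) ⟩
      E μ (λ x → E ζ (λ z → E D (cost (x Vec.++ z))))
        ≈⟨ E-product Vec._++_ μ ζ _ ⟨
      E (product Vec._++_ μ ζ) (λ y → E D (cost y)) ∎
      where
      D = atoms (trees d)
      split : ∀ x z t → cost x (fixʳ z t) + cost z (fixˡ x t) ≈ cost (x Vec.++ z) t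
      split x z t = trans (sym (fromℕ-+ (queries (fixʳ z t) x) (queries (fixˡ x t) z))) (reflexive
          (≡.cong fromℕ (queries-fix t x z)))

  -- Hardwiring never deepens a tree, so the depth bound W of the whole algorithm, and with it
  -- `hard`, stays applicable throughout the induction.
  direct-sum : ∀ n (f : PartialFunction m) {μ} → Supp (zeros f) (atoms μ) → Hard ε f W b μ →
               (d : 𝔇 ε (OR n ∘ f)) → DepthAtMost W (atoms (trees d)) →
               fromℕ n * b ≤ E (atoms (power n μ)) (λ y → 𝔼 d (cost y))
  direct-sum zero f μ-zeros hard d shallow =
    ≤-trans (≤-reflexive (zeroˡ _)) (E-nonneg (nonneg (point Vec.[])) (𝔼-cost-nonneg d))
  direct-sum {b = b} (suc n) f {μ} μ-zeros hard d shallow = begin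
    fromℕ (suc n) * b             ≈⟨ solve 2 (λ n b → (con (+ 1) :+ n) :* b := b :+ n :* b) refl (fromℕ n) b ⟩
    b + fromℕ n * b
      ≤⟨ +-mono-≤
           (hard (first-block n f d ζ ζ-zeros) (product-Supp ζ-zeros shallow (λ {z} {t} _ t≤W → ℕ.≤-trans
               (depth-restrict _ t) t≤W)))
           (direct-sum n f μ-zeros hard (other-blocks n f d μ μ-zeros)
             (product-Supp μ-zeros shallow (λ {x} {t} _ t≤W → ℕ.≤-trans (depth-restrict _ t) t≤W))) ⟩
    E (atoms μ) (λ x → 𝔼 (first-block n f d ζ ζ-zeros) (cost x)) +
    E (atoms ζ) (λ z → 𝔼 (other-blocks n f d μ μ-zeros) (cost z))
                                  ≈⟨ block-costs n f d μ μ-zeros ζ ζ-zeros ⟩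
    E (atoms (lift₂ Vec._++_ μ ζ)) (λ y → 𝔼 d (cost y)) ∎
    where
    open ≤-Reasoning
    ζ = power n μ
    ζ-zeros = power-zeros n f μ-zeros

  lower-bound : ∀ {c v} n (f : PartialFunction m) {x₀} → f x₀ ≡ just false → IsSingleCopyCost ε f c →
    (A : RandomizedAlgorithm (n ℕ.* m)) → A ∈ 𝔄 ε (OR n ∘ f) → PartialCostsBounded A (domain (OR n ∘ f)) v →
    fromℕ n * c ≤ v
  lower-bound {c = c} {v} n f fx₀ isCost A A∈𝔄 bounded = ≤-from-slack λ δ 0<δ →
    -- n portions for the loss of η on each block, one for the passage to finite randomness.
    let η , 0<η , [1+n]η≤δ = small-multiple (suc n) 0<δ
        d , cheap          = finite-approximation A A∈𝔄 bounded η 0<η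
        W , shallow        = depth-bound (atoms (trees d))
        μ , μ-zeros , hard = minimax isCost fx₀ W η 0<η
    in 0≤-diff⁻¹ (+-nonneg (0≤-diff (begin
         fromℕ n * (c - η)                                ≤⟨ direct-sum n f μ-zeros hard d shallow ⟩
         E (atoms (power n μ)) (λ y → 𝔼 d (cost y))
           ≤⟨ E-const-≤ (power n μ) (All.map (λ fy → cheap _ (domain-just (OR n ∘ f) fy)) (power-zeros n f μ-zeros)) ⟩
         v + η                                            ∎)) (0≤-diff [1+n]η≤δ))
       (solve 5 (λ n c η v δ → (v :+ η :- n :* (c :- η)) :+ (δ :- (con (+ 1) :+ n) :* η) :=
           v :+ δ :- n :* c) refl (fromℕ n) c η v δ)
    where open ≤-Reasoning

-- The upper bound: independent copies run in sequence

module UpperBound (em : ExcludedMiddle 0ℓ) (ℝ : CompleteOrderedField) where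

  open Algorithms em ℝ
  open Minimax em ℝ
  open Trees
  open ≤-Reasoning

  private variable
    N m : ℕ
    ε b : Carrier

  ∨-falseˡ : ∀ {p q} → p ∨ q ≡ false → p ≡ false
  ∨-falseˡ {false} _ = ≡.refl

  ∨-falseʳ : ∀ {p q} → p ∨ q ≡ false → q ≡ false
  ∨-falseʳ {false} eq = eq

  repeat : ∀ n → Dist (DecisionTree m) → Dist (DecisionTree (n ℕ.* m))
  repeat zero    d = point (output false)
  repeat (suc n) d = lift₂ _then_ d (repeat n d)

  repeat-sound : ∀ n (f : PartialFunction m) {d} → Supp (Sound f) (atoms d) →
                 Supp (Sound (OR n ∘ f)) (atoms (repeat n d))
  repeat-sound zero    f sound = (λ _ _ → ≡.refl) ∷ []
  repeat-sound (suc n) f sound = product-Supp sound (repeat-sound n f sound) (λ {t} {u} → then-sound {t} {u})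
    where
    then-sound : ∀ {t u} → Sound f t → Sound (OR n ∘ f) u → Sound (OR suc n ∘ f) (t then u)
    then-sound {t} {u} sound-t sound-u y fy with OR-suc n f y fy
    ... | x , z , p , q , ≡.refl , fx , fz , pq = ≡.trans (eval-then t u x z)
      (≡.cong₂ _∨_ (sound-t x (≡.trans fx (≡.cong just (∨-falseˡ pq))))
                   (sound-u z (≡.trans fz (≡.cong just (∨-falseʳ {p} pq)))))

  miss-then : ∀ (t : DecisionTree N) (u : DecisionTree m) x z → miss (x Vec.++ z) (t then u) ≡ 𝟙 (not
      (eval t x ∨ eval u z))
  miss-then t u x z = ≡.cong (𝟙 ∘ not) (eval-then t u x z)

  miss-thenˡ : ∀ (t : DecisionTree N) (u : DecisionTree m) x z → miss (x Vec.++ z) (t then u) ≤ miss x t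
  miss-thenˡ t u x z rewrite miss-then t u x z with eval t x
  ... | true  = ≤-refl
  ... | false = 𝟙≤1 (not (eval u z))

  miss-thenʳ : ∀ (t : DecisionTree N) (u : DecisionTree m) x z → miss (x Vec.++ z) (t then u) ≤ miss z u
  miss-thenʳ t u x z rewrite miss-then t u x z with eval t x
  ... | true  = 𝟙-nonneg (not (eval u z))
  ... | false = ≤-refl

  -- Here `miss x t` serves as the indicator that t rejects x, whether or not this is an error; only
  -- then is the second part paid for.
  cost-then : ∀ (t : DecisionTree N) (u : DecisionTree m) x z →
              cost (x Vec.++ z) (t then u) ≈ cost x t + miss x t * cost z u
  cost-then t u x z = begin-equality
    fromℕ (queries (t then u) (x Vec.++ z))                         ≡⟨ ≡.cong fromℕ (queries-then t u x z) ⟩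
    fromℕ (queries t x ℕ.+ (if eval t x then 0 else queries u z))   ≈⟨ fromℕ-+ (queries t x) _ ⟩
    cost x t + fromℕ (if eval t x then 0 else queries u z)          ≈⟨ +-congˡ (select (eval t x)) ⟩
    cost x t + miss x t * cost z u                                  ∎
    where
    select : ∀ b → fromℕ (if b then 0 else queries u z) ≈ 𝟙 (not b) * cost z u
    select true  = sym (zeroˡ _)
    select false = sym (*-identityˡ _)

  -- Rejecting the whole input entails rejecting a given block of value 1, so the error is that of a
  -- single copy and does not accumulate.
  repeat-error : ∀ n (f : PartialFunction m) (d : 𝔇 ε f) y → (OR n ∘ f) y ≡ just true →
                 E (atoms (repeat n (trees d))) (miss y) ≤ ε
  repeat-error zero    f d y ()
  repeat-error (suc n) f d y fy with OR-suc n f y fy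
  ... | x , z , true , _ , ≡.refl , fx , _ , _ = begin
    E (atoms (repeat (suc n) (trees d))) (miss (x Vec.++ z))   ≈⟨ E-product _then_ (atoms (trees d)) _ _ ⟩
    𝔼 d (λ t → E (atoms rest) (λ u → miss (x Vec.++ z) (t then u)))
      ≤⟨ E-mono′ (nonneg (trees d)) (λ t → E-const-≤ rest (All.universal (λ (_ , u) → miss-thenˡ t u x z) _)) ⟩
    𝔼 d (miss x)                                               ≤⟨ error d x fx ⟩
    _                                                          ∎
    where rest = repeat n (trees d)
  ... | x , z , false , true , ≡.refl , _ , fz , _ = begin
    E (atoms (repeat (suc n) (trees d))) (miss (x Vec.++ z))   ≈⟨ E-product _then_ (atoms (trees d)) _ _ ⟩
    𝔼 d (λ t → E (atoms rest) (λ u → miss (x Vec.++ z) (t then u)))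
      ≤⟨ E-const-≤ (trees d) (All.universal (λ (_ , t) → ≤-trans
           (E-mono′ (nonneg rest) (λ u → miss-thenʳ t u x z)) (repeat-error n f d z fz)) _) ⟩
    _                                                          ∎
    where rest = repeat n (trees d)

  repeated : ∀ n (f : PartialFunction m) → 𝔇 ε f → 𝔇 ε (OR n ∘ f)
  repeated n f d = alg (repeat n (trees d)) (repeat-sound n f (sound d)) (repeat-error n f d)

  -- Blocks before the first one of value 1 cost at most b each on average. That block is missed
  -- with probability 0, so the cost of what follows is multiplied by 0; its own cost is charged
  -- once, as D.
  repeated-cost : ∀ n (f : PartialFunction m) (d : 𝔇 ε f) → ε ≤ 0# → 0# ≤ b → (∀ x → zeros f x → 𝔼 d (cost x) ≤ b) →
    ∀ {D} → DepthAtMost D (atoms (trees d)) →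
    ∀ y {r} → (OR n ∘ f) y ≡ just r → 𝔼 (repeated n f d) (cost y) ≤ fromℕ n * b + fromℕ D
  repeated-cost {b = b} zero    f d ε≤0 0≤b cheap {D} shallow y fy =
    ≤-trans (≤-reflexive (E-point (output false) (cost y))) (+-nonneg (≤-reflexive (sym (zeroˡ b))) (fromℕ-nonneg D))
  repeated-cost {b = b} (suc n) f d ε≤0 0≤b cheap {D} shallow y fy with OR-suc n f y fy
  ... | x , z , p , q , ≡.refl , fx , fz , _ = begin
    𝔼 (repeated (suc n) f d) (cost (x Vec.++ z))        ≈⟨ E-product _then_ (atoms (trees d)) _ _ ⟩
    𝔼 d (λ t → E rest (λ u → cost (x Vec.++ z) (t then u)))
      ≈⟨ E-cong (atoms (trees d)) split ⟩
    𝔼 d (λ t → cost x t + C * miss x t)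
        ≈⟨ trans (E-+ (atoms (trees d)) _ _) (+-congˡ (E-*ˡ (atoms (trees d)) C (miss x))) ⟩
    𝔼 d (cost x) + C * 𝔼 d (miss x)                     ≤⟨ by-value p fx ⟩
    fromℕ (suc n) * b + fromℕ D                         ∎
    where
    rest = atoms (repeat n (trees d))
    C = E rest (cost z)
    0≤C : 0# ≤ C
    0≤C = 𝔼-cost-nonneg (repeated n f d) z
    split : ∀ t → E rest (λ u → cost (x Vec.++ z) (t then u)) ≈ cost x t + C * miss x t
    split t = trans (E-cong rest (λ u → cost-then t u x z)) (trans (E-+ rest _ _)
      (+-cong (E-dist-const (repeat n (trees d)) (cost x t)) (trans (E-*ˡ rest (miss x t) (cost z)) (*-comm _ _))))
    by-value : ∀ p → f x ≡ just p → 𝔼 d (cost x) + C * 𝔼 d (miss x) ≤ fromℕ (suc n) * b + fromℕ D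
    by-value true fx = begin
      𝔼 d (cost x) + C * 𝔼 d (miss x)
          ≤⟨ +-mono-≤ (𝔼-cost≤depth d shallow x) (*-monoʳ-≤ 0≤C (≤-trans (error d x fx) ε≤0)) ⟩
      fromℕ D + C * 0#                  ≈⟨ solve 2 (λ D C → D :+ C :* con (+ 0) := con (+ 0) :+ D) refl (fromℕ D) C ⟩
      0# + fromℕ D                      ≤⟨ +-monoˡ-≤ _ (*-nonneg (fromℕ-nonneg (suc n)) 0≤b) ⟩
      fromℕ (suc n) * b + fromℕ D       ∎
    by-value false fx = begin
      𝔼 d (cost x) + C * 𝔼 d (miss x)
        ≤⟨ +-mono-≤ (cheap x fx) (*-mono-≤ 0≤C (repeated-cost n f d ε≤0 0≤b cheap shallow z fz)
             (E-nonneg (nonneg (trees d)) (λ t → 𝟙-nonneg (not (eval t x))))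
             (E-const-≤ (trees d) (All.universal (λ (_ , t) → 𝟙≤1 (not (eval t x))) _))) ⟩
      b + (fromℕ n * b + fromℕ D) * 1#
          ≈⟨ solve 3 (λ n b D → b :+ (n :* b :+ D) :* con (+ 1) :=
              (con (+ 1) :+ n) :* b :+ D) refl (fromℕ n) b (fromℕ D) ⟩
      fromℕ (suc n) * b + fromℕ D       ∎

  -- The error caused by a query budget

  -- q is the total budget and a the number of queries already spent on earlier blocks, so that the
  -- recursion on blocks can carry the budget along.
  within : ℕ → ℕ → Vec Bool N → DecisionTree N → Bool
  within q a y t = eval t y ∧ (a ℕ.+ queries t y ℕ.≤ᵇ q)

  overrun : ℕ → ℕ → Vec Bool N → DecisionTree N → Carrier
  overrun q a y t = 𝟙 (not (within q a y t))

  miss-truncate : ∀ q y (t : DecisionTree N) → miss y (truncate q t) ≤ overrun q 0 y t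
  miss-truncate q y t with eval t y in eq
  ... | false rewrite eval-truncate-false q t y eq = ≤-refl
  ... | true with queries t y ℕ.≤ᵇ q in le
  ...   | false = 𝟙≤1 _
  ...   | true rewrite eval-truncate-≤ q t y (ℕ.≤ᵇ⇒≤ _ _ (≡.subst T (≡.sym le) tt)) | eq = ≤-refl

  overrun-then-reject : ∀ q a (t : DecisionTree N) (u : DecisionTree m) x z → eval t x ≡ false →
    overrun q a (x Vec.++ z) (t then u) ≡ overrun q (a ℕ.+ queries t x) z u
  overrun-then-reject q a t u x z eq
    rewrite eval-then t u x z | queries-then t u x z | eq | ℕ.+-assoc a (queries t x) (queries u z) = ≡.refl

  overrun-then-accept : ∀ q a {D} (t : DecisionTree N) (u : DecisionTree m) x z → queries t x ℕ.≤ D → a ℕ.+ D ℕ.≤ q →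
    overrun q a (x Vec.++ z) (t then u) ≤ miss x t
  overrun-then-accept q a t u x z t≤D a+D≤q rewrite eval-then t u x z | queries-then t u x z with eval t x
  ... | false = 𝟙≤1 _
  ... | true with a ℕ.+ (queries t x ℕ.+ 0) ℕ.≤ᵇ q in le
  ...   | true  = ≤-refl
  ...   | false = contradiction (≡.subst T le (ℕ.≤⇒≤ᵇ (ℕ.≤-trans (ℕ.+-monoʳ-≤ a
    (ℕ.≤-trans (ℕ.≤-reflexive (ℕ.+-identityʳ _)) t≤D)) a+D≤q))) id

  -- A Chebyshev bound: before the first block with value 1 the cost is a sum
  -- of independent terms of mean at most b, and that block, unless missed,
  -- ends the run at an additional cost of at most D.
  module Concentration {m : ℕ} {f : PartialFunction m} (d : 𝔇 ε f) (cheap : ∀ x → zeros f x → 𝔼 d (cost x) ≤ b)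
    (D : ℕ) (shallow : DepthAtMost D (atoms (trees d)))
    (q : ℕ) {s σ : Carrier} (0≤s : 0# ≤ s) (0≤σ : 0# ≤ σ) (1≤s²σ : 1# ≤ (s * s) * σ) where

    M : Carrier
    M = deviation-bound D b

    M-nonneg : 0# ≤ M
    M-nonneg = ≤-trans (square-nonneg (0# - b)) (squared-deviation D b ≤-refl (fromℕ-nonneg D))

    -- How far the run is behind schedule: the queries spent, b for each remaining block, D for the
    -- block that ends the run and the slack s, compared with the budget q.
    lag : ℕ → ℕ → Carrier
    lag n a = s + fromℕ n * b + fromℕ D + fromℕ a - fromℕ q

    -- Chebyshev's quotient with σ in the place of 1/s²: the squared positive lag, plus a variance
    -- of at most M for each remaining block.
    overrun-bound : ℕ → ℕ → Carrier
    overrun-bound n a = (lag n a ⁺² + fromℕ n * M) * σ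

    overrun-bound-nonneg : ∀ n a → 0# ≤ overrun-bound n a
    overrun-bound-nonneg n a =
      *-nonneg (+-nonneg (*-nonneg (⁺-nonneg _) (⁺-nonneg _)) (*-nonneg (fromℕ-nonneg n) M-nonneg)) 0≤σ

    -- Once fewer than D queries are left, the lag is at least s, and as a bound on a probability
    -- the estimate becomes trivial.
    late : ∀ n a → 0# ≤ b → q ℕ.< a ℕ.+ D → 1# ≤ overrun-bound n a
    late n a 0≤b q<a+D = begin
      1#                               ≤⟨ 1≤s²σ ⟩
      (s * s) * σ                      ≤⟨ *-monoˡ-≤ 0≤σ (begin
        s * s                            ≤⟨ square≤⁺² 0≤s s≤lag ⟩
        lag n a ⁺²                       ≤⟨ x≤x+y (*-nonneg (fromℕ-nonneg n) M-nonneg) ⟩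
        lag n a ⁺² + fromℕ n * M         ∎) ⟩
      overrun-bound n a                ∎
      where
      q≤a+D : fromℕ q ≤ fromℕ a + fromℕ D
      q≤a+D = ≤-trans (fromℕ-mono (ℕ.<⇒≤ q<a+D)) (≤-reflexive (fromℕ-+ a D))
      s≤lag : s ≤ lag n a
      s≤lag = 0≤-diff⁻¹ (+-nonneg (0≤-diff q≤a+D) (*-nonneg (fromℕ-nonneg n) 0≤b))
        (solve 6 (λ s n b D a q → (a :+ D :- q) :+ n :* b := s :+ n :* b :+ D :+ a :- q :- s) refl
          s (fromℕ n) b (fromℕ D) (fromℕ a) (fromℕ q))

    -- The bound is a supermartingale on blocks of value 0: the lag changes by `cost x t - b`, which
    -- has mean at most 0 and square at most M, and the finished block releases one M.
    overrun-mean : ∀ n a x → zeros f x → 𝔼 d (λ t → overrun-bound n (a ℕ.+ queries t x)) ≤ overrun-bound (suc n) a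
    overrun-mean n a x fx = begin
      𝔼 d (λ t → overrun-bound n (a ℕ.+ queries t x))
        ≤⟨ E-mono (nonneg (trees d)) (All.map (λ {(_ , t)} t≤D → ≤-trans (*-monoˡ-≤ 0≤σ (+-monoˡ-≤ _
            (lag² t t≤D))) (≤-reflexive (*-comm _ σ))) shallow) ⟩
      𝔼 d (λ t → σ * (L ⁺² + 2# * (L ⁺ * (cost x t - b)) + M + fromℕ n * M))
        ≈⟨ trans (E-*ˡ l σ _) (*-congˡ (trans (E-cong l (λ t → regroup (L ⁺²) (L ⁺) (cost x t) M (fromℕ n)))
             (trans (E-+ l _ _) (+-cong (E-*ˡ l (2# * L ⁺) (cost x)) (E-dist-const (trees d) _))))) ⟩
      σ * ((2# * L ⁺) * 𝔼 d (cost x) + (L ⁺² - (2# * L ⁺) * b + (M + fromℕ n * M)))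
        ≤⟨ *-monoʳ-≤ 0≤σ (+-monoˡ-≤ _ (*-monoʳ-≤ (*-nonneg (+-nonneg 0≤1 0≤1) (⁺-nonneg L)) (cheap x fx))) ⟩
      σ * ((2# * L ⁺) * b + (L ⁺² - (2# * L ⁺) * b + (M + fromℕ n * M)))
        ≈⟨ solve 6 (λ σ k b S M n → σ :* (k :* b :+ (S :- k :* b :+ (M :+ n :* M))) :=
            (S :+ (con (+ 1) :+ n) :* M) :* σ)
             refl σ (2# * L ⁺) b (L ⁺²) M (fromℕ n) ⟩
      overrun-bound (suc n) a ∎
      where
      l = atoms (trees d)
      L = lag (suc n) a
      2# = 1# + 1#
      regroup : ∀ S p u M n → S + 2# * (p * (u - b)) + M + n * M ≈ (2# * p) * u + (S - (2# * p) * b + (M + n * M))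
      regroup S p u M n = solve 6 (λ S p u M n b →
        S :+ (con (+ 1) :+ con (+ 1)) :* (p :* (u :- b)) :+ M :+ n :* M :=
        ((con (+ 1) :+ con (+ 1)) :* p) :* u :+ (S :- ((con (+ 1) :+ con (+ 1)) :* p) :* b :+
            (M :+ n :* M))) refl S p u M n b
      lag² : ∀ t → depth t ℕ.≤ D → lag n (a ℕ.+ queries t x) ⁺² ≤ L ⁺² + 2# * (L ⁺ * (cost x t - b)) + M
      lag² t t≤D = begin
        lag n (a ℕ.+ queries t x) ⁺²
          ≤⟨ ⁺²-mono (≤-reflexive (trans (+-congʳ (+-congˡ (fromℕ-+ a (queries t x))))
               (solve 7 (λ s n b D a q u → s :+ n :* b :+ D :+ (a :+ u) :- q :=
                  (s :+ (con (+ 1) :+ n) :* b :+ D :+ a :- q) :+ (u :- b)) refl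
                  s (fromℕ n) b (fromℕ D) (fromℕ a) (fromℕ q) (cost x t)))) ⟩
        (L + (cost x t - b)) ⁺²         ≤⟨ ⁺²-+ L (cost x t - b) ⟩
        L ⁺² + 2# * (L ⁺ * (cost x t - b)) + (cost x t - b) * (cost x t - b)
          ≤⟨ +-monoʳ-≤ _ (squared-deviation D b (fromℕ-nonneg (queries t x)) (fromℕ-mono (ℕ.≤-trans
              (queries≤depth t x) t≤D))) ⟩
        L ⁺² + 2# * (L ⁺ * (cost x t - b)) + M ∎

    overrun≤ : 0# ≤ b → 0# ≤ ε → ∀ n a y → (OR n ∘ f) y ≡ just true →
               E (atoms (repeat n (trees d))) (overrun q a y) ≤ ε + overrun-bound n a
    overrun≤ 0≤b 0≤ε zero    a y ()
    overrun≤ 0≤b 0≤ε (suc n) a y fy with OR-suc n f y fy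
    ... | x , z , p , r , ≡.refl , fx , fz , pr = begin
      E (atoms (repeat (suc n) (trees d))) (overrun q a (x Vec.++ z))   ≈⟨ E-product _then_ (atoms (trees d)) _ _ ⟩
      𝔼 d (λ t → E (atoms rest) (λ u → overrun q a (x Vec.++ z) (t then u)))  ≤⟨ by-value p r fx fz pr ⟩
      ε + overrun-bound (suc n) a                                       ∎
      where
      rest = repeat n (trees d)
      by-value : ∀ p r → f x ≡ just p → (OR n ∘ f) z ≡ just r → p ∨ r ≡ true →
                 𝔼 d (λ t → E (atoms rest) (λ u → overrun q a (x Vec.++ z) (t then u))) ≤ ε + overrun-bound (suc n) a
      -- A sound tree never accepts a zero, so the run passes to the remaining blocks with its
      -- queries added to a.
      by-value false true fx fz _ = begin
        𝔼 d (λ t → E (atoms rest) (λ u → overrun q a (x Vec.++ z) (t then u)))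
          ≤⟨ E-mono (nonneg (trees d)) (All.map (λ {(_ , t)} sound-t → ≤-trans
               (≤-reflexive (E-cong (atoms rest) (λ u → reflexive (overrun-then-reject q a t u x z (sound-t x fx)))))
               (overrun≤ 0≤b 0≤ε n (a ℕ.+ queries t x) z fz)) (sound d)) ⟩
        𝔼 d (λ t → ε + overrun-bound n (a ℕ.+ queries t x))
          ≈⟨ trans (E-+ (atoms (trees d)) _ _) (+-congʳ (E-dist-const (trees d) ε)) ⟩
        ε + 𝔼 d (λ t → overrun-bound n (a ℕ.+ queries t x))
          ≤⟨ +-monoʳ-≤ ε (overrun-mean n a x fx) ⟩
        ε + overrun-bound (suc n) a ∎
      -- Either there is room for D more queries and only a miss can fail, or the bound is already
      -- at least 1.
      by-value true r fx _ _ with ℕ.≤-<-connex (a ℕ.+ D) q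
      ... | inj₁ a+D≤q = begin
        𝔼 d (λ t → E (atoms rest) (λ u → overrun q a (x Vec.++ z) (t then u)))
          ≤⟨ E-mono (nonneg (trees d)) (All.map (λ {(_ , t)} t≤D → E-const-≤ rest (All.universal (λ (_ , u) →
               overrun-then-accept q a t u x z (ℕ.≤-trans (queries≤depth t x) t≤D) a+D≤q) _)) shallow) ⟩
        𝔼 d (miss x)                    ≤⟨ error d x fx ⟩
        ε                               ≤⟨ x≤x+y (overrun-bound-nonneg (suc n) a) ⟩
        ε + overrun-bound (suc n) a     ∎
      ... | inj₂ q<a+D = begin
        𝔼 d (λ t → E (atoms rest) (λ u → overrun q a (x Vec.++ z) (t then u)))
          ≤⟨ E-const-≤ (trees d) (All.universal (λ (_ , t) → E-const-≤ rest (All.universal (λ (_ , u) →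
               𝟙≤1 (not (within q a (x Vec.++ z) (t then u)))) _)) _) ⟩
        1#                              ≤⟨ late (suc n) a 0≤b q<a+D ⟩
        overrun-bound (suc n) a         ≈⟨ +-identityˡ _ ⟨
        0# + overrun-bound (suc n) a    ≤⟨ +-monoˡ-≤ _ 0≤ε ⟩
        ε + overrun-bound (suc n) a     ∎

  truncate-sound : ∀ q {g : PartialFunction N} {t} → Sound g t → Sound g (truncate q t)
  truncate-sound q {t = t} sound-t y gy = eval-truncate-false q t y (sound-t y gy)

  cheap-algorithm : ∀ {c} {f : PartialFunction m} → IsSingleCopyCost ε f c → ∀ η → 0# < η →
    ∃[ d ] (∀ x → zeros f x → 𝔼 {ε = ε} {f} d (cost x) ≤ c + (η + η))
  cheap-algorithm {c = c} isCost η 0<η =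
    let v , (A , A∈𝔄 , isMax) , v≤c+η = approaches-infimum isCost 0<η
        d , cheap = finite-approximation A A∈𝔄 (maxExpectedCost⇒bounded A isMax) η 0<η
    in d , λ x fx → begin
      𝔼 d (cost x)     ≤⟨ cheap x fx ⟩
      v + η            ≤⟨ +-monoˡ-≤ η v≤c+η ⟩
      c + η + η        ≈⟨ solve 2 (λ c η → c :+ η :+ η := c :+ (η :+ η)) refl c η ⟩
      c + (η + η)      ∎

  abstract
    zero-error-upper : ∀ {c} {f : PartialFunction m} {x₀} → f x₀ ≡ just false → IsSingleCopyCost ε f c → ε ≤ 0# →
      ∀ δ → 0# < δ → ∃[ K ] (∀ n → K ℕ.≤ n →
        ∃[ d ] (∀ y → domain (OR n ∘ f) y → 𝔼 {ε = ε} {OR n ∘ f} d (cost y) ≤ fromℕ n * (c + δ)))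
    zero-error-upper {c = c} {f} {x₀} fx₀ isCost ε≤0 δ 0<δ =
      -- Two η belong to `cheap-algorithm` (nearing the infimum, finite randomness); the third
      -- absorbs the constant D once n is large.
      let η , 0<η , 3η≤δ = small-multiple 3 0<δ
          d , cheap      = cheap-algorithm isCost η 0<η
          D , shallow    = depth-bound (atoms (trees d))
          K , D≤Kη       = archimedean-* (fromℕ D) 0<η
          0≤b            = ≤-trans (𝔼-cost-nonneg d x₀) (cheap x₀ fx₀)
      in K , λ n K≤n → repeated n f d , λ y y∈ → begin
        𝔼 (repeated n f d) (cost y)
          ≤⟨ repeated-cost n f d ε≤0 0≤b cheap shallow y (proj₂ (just-value (OR n ∘ f) y y∈)) ⟩
        fromℕ n * (c + (η + η)) + fromℕ D
          ≤⟨ +-monoʳ-≤ _ (≤-trans D≤Kη (*-monoˡ-≤ (proj₁ 0<η) (fromℕ-mono K≤n))) ⟩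
        fromℕ n * (c + (η + η)) + fromℕ n * η
          ≈⟨ solve 3 (λ n c η → n :* (c :+ (η :+ η)) :+ n :* η :=
               n :* (c :+ (con (+ 1) :+ (con (+ 1) :+ (con (+ 1) :+ con (+ 0)))) :* η)) refl (fromℕ n) c η ⟩
        fromℕ n * (c + fromℕ 3 * η)
          ≤⟨ *-monoʳ-≤ (fromℕ-nonneg n) (+-monoʳ-≤ c 3η≤δ) ⟩
        fromℕ n * (c + δ) ∎
      where
      just-value : ∀ (g : PartialFunction N) y → domain g y → ∃[ r ] g y ≡ just r
      just-value g y y∈ with g y
      just-value g y (any-just _) | just r = r , ≡.refl

  -- Mixing in the exact algorithm with probability lam makes room for the
  -- error caused by cutting off long runs.
  amplified : ∀ {lam} {f : PartialFunction m} → 0# ≤ lam → lam ≤ 1# → 𝔇 ε f → 𝔇 (ε - lam * ε) f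
  amplified {ε = ε} {lam} {f} 0≤lam lam≤1 d = alg (mixture 0≤lam lam≤1 (point (exact f)) (trees d))
    (All.++⁺ (scale-Supp _ ((λ y fy → eval-exact f y fy) ∷ [])) (scale-Supp _ (sound d)))
    λ x fx → begin
      E (atoms (mixture 0≤lam lam≤1 (point (exact f)) (trees d))) (miss x)
        ≈⟨ E-mixture 0≤lam lam≤1 (point (exact f)) (trees d) (miss x) ⟩
      lam * E (atoms (point (exact f))) (miss x) + (1# - lam) * 𝔼 d (miss x)
        ≤⟨ +-mono-≤ (≤-reflexive (trans (*-congˡ (trans (E-point (exact f) (miss x)) (miss-exact f x fx)))
            (zeroʳ lam)))
                    (*-monoʳ-≤ (0≤-diff lam≤1) (error d x fx)) ⟩
      0# + (1# - lam) * ε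
        ≈⟨ solve 2 (λ l ε → con (+ 0) :+ (con (+ 1) :- l) :* ε := ε :- l :* ε) refl lam ε ⟩
      ε - lam * ε ∎

  amplified-cost : ∀ {lam v η} {f : PartialFunction m} (0≤lam : 0# ≤ lam) (lam≤1 : lam ≤ 1#) (d : 𝔇 ε f) →
    lam * fromℕ m ≤ η → ∀ x → 𝔼 d (cost x) ≤ v → 𝔼 (amplified 0≤lam lam≤1 d) (cost x) ≤ v + η
  amplified-cost {m = m} {lam = lam} {v} {η} {f} 0≤lam lam≤1 d lam-m≤η x d≤v = begin
    E (atoms (mixture 0≤lam lam≤1 (point (exact f)) (trees d))) (cost x)
      ≈⟨ E-mixture 0≤lam lam≤1 (point (exact f)) (trees d) (cost x) ⟩
    lam * E (atoms (point (exact f))) (cost x) + (1# - lam) * 𝔼 d (cost x)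
      ≤⟨ +-mono-≤ (≤-trans (≤-reflexive (*-congˡ (trans (E-point (exact f) (cost x)) (cost-exact f x)))) lam-m≤η)
           (0≤-diff⁻¹ (+-nonneg (0≤-diff d≤v) (*-nonneg 0≤lam (𝔼-cost-nonneg d x)))
             (solve 3 (λ l e v → (v :- e) :+ l :* e := v :- (con (+ 1) :- l) :* e) refl lam (𝔼 d (cost x)) v)) ⟩
    η + v   ≈⟨ +-comm η v ⟩
    v + η   ∎

  -- θ stands for the smaller of 1 and η; dividing it by k + 1 settles both demands on lam.
  small-probability-≤1 : ∀ k {η θ} → 0# < θ → θ ≤ 1# → θ ≤ η →
                         ∃[ lam ] (0# < lam × lam ≤ 1# × lam * fromℕ k ≤ η)
  small-probability-≤1 k {η} {θ} 0<θ θ≤1 θ≤η =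
    let lam , 0<lam , [1+k]lam≤θ = small-multiple (suc k) 0<θ
    in lam , 0<lam ,
       ≤-trans (0≤-diff⁻¹ (*-nonneg (fromℕ-nonneg k) (proj₁ 0<lam))
         (solve 2 (λ k l → k :* l := (con (+ 1) :+ k) :* l :- l) refl (fromℕ k) lam)) (≤-trans [1+k]lam≤θ θ≤1) ,
       ≤-trans (0≤-diff⁻¹ (proj₁ 0<lam)
         (solve 2 (λ k l → l := (con (+ 1) :+ k) :* l :- l :* k) refl (fromℕ k) lam)) (≤-trans [1+k]lam≤θ θ≤η)

  small-probability : ∀ k {η} → 0# < η → ∃[ lam ] (0# < lam × lam ≤ 1# × lam * fromℕ k ≤ η)
  small-probability k {η} 0<η with 1# ≤? η
  ... | inj₁ 1≤η = small-probability-≤1 k 0<1 ≤-refl 1≤η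
  ... | inj₂ η<1 = small-probability-≤1 k 0<η (proj₁ η<1) ≤-refl

  truncated : ∀ {ε′} q {g : PartialFunction N} (d : 𝔇 ε g) →
    (∀ y → g y ≡ just true → 𝔼 d (overrun q 0 y) ≤ ε′) →
    ∃[ d′ ] Supp (λ t → ∀ y → queries t y ℕ.≤ q) (atoms (trees {ε = ε′} {g} d′))
  truncated q {g} d overrun≤ε′ =
    alg (push-dist (truncate q) (trees d))
      (All.map⁺ (All.map (λ {(_ , t)} → truncate-sound q {g} {t}) (sound d)))
      (λ y gy → begin
        E (push (truncate q) (atoms (trees d))) (miss y)   ≈⟨ E-push (truncate q) (atoms (trees d)) (miss y) ⟩
        𝔼 d (λ t → miss y (truncate q t))                  ≤⟨ E-mono′ (nonneg (trees d)) (miss-truncate q y) ⟩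
        𝔼 d (overrun q 0 y)                                ≤⟨ overrun≤ε′ y gy ⟩
        _                                                  ∎) ,
    All.map⁺ (All.universal (λ (_ , t) → queries-truncate q t) _)

  ⁺²-nonpos : ∀ {x} → x ≤ 0# → x ⁺² ≤ 0#
  ⁺²-nonpos {x} x≤0 = ≤-trans (*-mono-≤ (⁺-nonneg x) x⁺≤0 (⁺-nonneg x) x⁺≤0) (≤-reflexive (zeroˡ 0#))
    where x⁺≤0 = ⁺-least x≤0 ≤-refl

  -- With slack s = n η, the variance n M over s² is M / (n η²), which the last hypothesis makes at
  -- most τ. The second η in the cost pays for D and for rounding the budget to an integer.
  budgeted : ∀ {f : PartialFunction m} n (d : 𝔇 ε f) → 0# ≤ ε → 0# ≤ b → (∀ x → zeros f x → 𝔼 d (cost x) ≤ b) →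
    ∀ D → DepthAtMost D (atoms (trees d)) →
    ∀ {η τ ε′} → 0# < η → 0# ≤ τ → ε + τ ≤ ε′ → 1 ℕ.≤ n → fromℕ D + 1# ≤ fromℕ n * η →
    deviation-bound D b ≤ fromℕ n * ((η * η) * τ) →
    ∃[ d′ ] ∃[ q ] (Supp (λ t → ∀ y → queries t y ℕ.≤ q) (atoms (trees {ε = ε′} {OR n ∘ f} d′)) ×
                    fromℕ q ≤ fromℕ n * (b + (η + η)))
  budgeted {ε = ε} {b} {f} n@(suc k) d 0≤ε 0≤b cheap D shallow {η} {τ} {ε′} 0<η 0≤τ ε+τ≤ε′ _ D+1≤nη M≤nη²τ =
    proj₁ short , q , proj₂ short , (begin
      fromℕ q                                       ≤⟨ proj₂ (proj₂ rounded) ⟩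
      s + fromℕ n * b + fromℕ D + 1#
          ≈⟨ solve 3 (λ x D o → x :+ D :+ o := x :+ (D :+ o)) refl (s + fromℕ n * b) (fromℕ D) 1# ⟩
      s + fromℕ n * b + (fromℕ D + 1#)              ≤⟨ +-monoʳ-≤ _ D+1≤nη ⟩
      s + fromℕ n * b + fromℕ n * η
          ≈⟨ solve 3 (λ n b η → n :* η :+ n :* b :+ n :* η := n :* (b :+ (η :+ η))) refl (fromℕ n) b η ⟩
      fromℕ n * (b + (η + η))                       ∎)
    where
    s σ : Carrier
    s = fromℕ n * η
    σ = (s * s) ⁻¹
    0<s : 0# < s
    0<s = *-pos (0<suc k) 0<η
    0<s² : 0# < s * s
    0<s² = *-pos 0<s 0<s
    s²σ≈1 : (s * s) * σ ≈ 1#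
    s²σ≈1 = ⁻¹-inverseʳ _ (>-nonzero 0<s²)
    0≤nb : 0# ≤ fromℕ n * b
    0≤nb = *-nonneg (fromℕ-nonneg n) 0≤b
    rounded : ∃[ q ] (s + fromℕ n * b + fromℕ D ≤ fromℕ q × fromℕ q ≤ s + fromℕ n * b + fromℕ D + 1#)
    rounded = ceiling (+-nonneg (+-nonneg (proj₁ 0<s) 0≤nb) (fromℕ-nonneg D))
    -- Rounding up makes the initial lag nonpositive, so only the variance term of `overrun-bound`
    -- remains.
    q = proj₁ rounded
    open Concentration d cheap D shallow q (proj₁ 0<s) (⁻¹-nonneg 0<s²) (≤-reflexive (sym s²σ≈1))
    lag≤0 : lag n 0 ≤ 0#
    lag≤0 = 0≤-diff⁻¹ (0≤-diff (proj₁ (proj₂ rounded)))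
      (solve 2 (λ x q → q :- x := con (+ 0) :- (x :+ con (+ 0) :- q)) refl (s + fromℕ n * b + fromℕ D) (fromℕ q))
    overrun-bound≤τ : overrun-bound n 0 ≤ τ
    overrun-bound≤τ = begin
      (lag n 0 ⁺² + fromℕ n * M) * σ
        ≤⟨ *-monoˡ-≤ (⁻¹-nonneg 0<s²) (+-mono-≤ (⁺²-nonpos lag≤0) (*-monoʳ-≤ (fromℕ-nonneg n) M≤nη²τ)) ⟩
      (0# + fromℕ n * (fromℕ n * ((η * η) * τ))) * σ
        ≈⟨ solve 4 (λ n η τ σ → (con (+ 0) :+ n :* (n :* ((η :* η) :* τ))) :* σ :=
            (((n :* η) :* (n :* η)) :* σ) :* τ) refl (fromℕ n) η τ σ ⟩
      ((s * s) * σ) * τ        ≈⟨ trans (*-congʳ s²σ≈1) (*-identityˡ τ) ⟩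
      τ                        ∎
    short = truncated q (repeated n f d) λ y fy →
      ≤-trans (overrun≤ 0≤b 0≤ε n 0 y fy) (≤-trans (+-monoʳ-≤ ε overrun-bound≤τ) ε+τ≤ε′)

  abstract
    positive-error-upper : ∀ {c} {f : PartialFunction m} {x₀} → f x₀ ≡ just false → IsSingleCopyCost ε f c → 0# < ε →
      ∀ δ → 0# < δ → ∃[ K ] (∀ n → K ℕ.≤ n →
        ∃[ d ] ∃[ q ] (Supp (λ t → ∀ y → queries t y ℕ.≤ q) (atoms (trees {ε = ε} {OR n ∘ f} d)) ×
                       fromℕ q ≤ fromℕ n * (c + δ)))
    positive-error-upper {m = m} {ε} {c} {f} {x₀} fx₀ isCost 0<ε δ 0<δ =
      -- Two η from `cheap-algorithm`, one from mixing in the exact algorithm, two from `budgeted`.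
      let η , 0<η , 5η≤δ                = small-multiple 5 0<δ
          lam , 0<lam , lam≤1 , lam-m≤η = small-probability m 0<η
          d₀ , cheap₀                   = cheap-algorithm isCost η 0<η
          d                             = amplified (proj₁ 0<lam) lam≤1 d₀
          b                             = c + (η + η) + η
          D , shallow                   = depth-bound (atoms (trees d))
          cheap                         = λ x fx → amplified-cost (proj₁ 0<lam) lam≤1 d₀ lam-m≤η x (cheap₀ x fx)
          0≤b                           = ≤-trans (𝔼-cost-nonneg d x₀) (cheap x₀ fx₀)
          0≤ε-lam                       = 0≤-diff⁻¹ (*-nonneg (0≤-diff lam≤1) (proj₁ 0<ε))
            (solve 2 (λ l ε → (con (+ 1) :- l) :* ε := ε :- l :* ε :- con (+ 0)) refl lam ε)
          -- τ = lam * ε is exactly the error freed by the mixing; it is available for the runs that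
          -- are cut.
          0<τ                           = *-pos 0<lam 0<ε
          K₁ , D+1≤K₁η                  = archimedean-* (fromℕ D + 1#) 0<η
          K₂ , M≤K₂η²τ                  = archimedean-* (deviation-bound D b) (*-pos (*-pos 0<η 0<η) 0<τ)
      in K₁ ℕ.⊔ K₂ ℕ.⊔ 1 , λ n K≤n →
        let K₁⊔K₂≤n = ℕ.m⊔n≤o⇒m≤o (K₁ ℕ.⊔ K₂) 1 K≤n
            d′ , q , short , q≤ = budgeted n d 0≤ε-lam 0≤b cheap D shallow 0<η (proj₁ 0<τ)
              (≤-reflexive (solve 2 (λ l ε → ε :- l :* ε :+ l :* ε := ε) refl lam ε))
              (ℕ.m⊔n≤o⇒n≤o (K₁ ℕ.⊔ K₂) 1 K≤n)
              (≤-trans D+1≤K₁η (*-monoˡ-≤ (proj₁ 0<η) (fromℕ-mono (ℕ.m⊔n≤o⇒m≤o K₁ K₂ K₁⊔K₂≤n))))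
              (≤-trans M≤K₂η²τ (*-monoˡ-≤ (*-nonneg (square-nonneg η) (proj₁ 0<τ)) (fromℕ-mono
                  (ℕ.m⊔n≤o⇒n≤o K₁ K₂ K₁⊔K₂≤n))))
        in d′ , q , short , (begin
          fromℕ q                              ≤⟨ q≤ ⟩
          fromℕ n * (b + (η + η))
              ≈⟨ *-congˡ (solve 2 (λ c η → c :+ (η :+ η) :+ η :+ (η :+ η) := c :+ five :* η) refl c η) ⟩
          fromℕ n * (c + fromℕ 5 * η)          ≤⟨ *-monoʳ-≤ (fromℕ-nonneg n) (+-monoʳ-≤ c 5η≤δ) ⟩
          fromℕ n * (c + δ)                    ∎)
      where
      five : ∀ {k} → Polynomial k
      five = con (+ 1) :+ (con (+ 1) :+ (con (+ 1) :+ (con (+ 1) :+ (con (+ 1) :+ con (+ 0)))))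

-- The two limits

module Limits (em : ExcludedMiddle 0ℓ) (ℝ : CompleteOrderedField) where

  open Algorithms em ℝ
  open Minimax em ℝ
  open DirectSum em ℝ using (lower-bound)
  open UpperBound em ℝ

  module _ {m : ℕ} (f : PartialFunction m) {x₀ : Vec Bool m} (fx₀ : f x₀ ≡ just false) {ε c : Carrier} (0≤ε : 0# ≤ ε)
    (isCost : IsSingleCopyCost ε f c) where

    domain-nonempty : ∀ n → ∃[ y ] domain (OR n ∘ f) y
    domain-nonempty n = let y , fy = Trees.zero-OR n f fx₀ in y , domain-just (OR n ∘ f) fy

    R̄-limit : ∃[ R̄ ] ((∀ n → IsR̄ ε (OR n ∘ f) (R̄ n)) × ((λ n → R̄ n / n) ⟶ c))
    R̄-limit = (λ n → proj₁ (R̄ n)) , (λ n → proj₂ (R̄ n)) , squeeze lower upper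
      where
      R̄ : ∀ n → ∃[ r ] IsR̄ ε (OR n ∘ f) r
      R̄ n = infimum-exists 0≤ε (OR n ∘ f) (domain-nonempty n)
      lower : ∀ n → fromℕ n * c ≤ proj₁ (R̄ n)
      lower n = proj₂ (proj₂ (R̄ n)) _ λ v (A , A∈𝔄 , isMax) →
        lower-bound n f fx₀ isCost A A∈𝔄 (maxExpectedCost⇒bounded A isMax)
      upper : ∀ δ → 0# < δ → ∃[ K ] (∀ n → K ℕ.≤ n → proj₁ (R̄ n) ≤ fromℕ n * (c + δ))
      upper δ 0<δ with ε ≤? 0#
      ... | inj₁ ε≤0 =
        let K , cheap = zero-error-upper fx₀ isCost ε≤0 δ 0<δ
        in K , λ n K≤n → let d , d≤ = cheap n K≤n in infimum≤ (proj₂ (R̄ n)) (domain-nonempty n) d d≤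
      -- A worst-case budget bounds the expectation too, so the truncated algorithms serve both
      -- limits.
      ... | inj₂ 0<ε =
        let K , short = positive-error-upper fx₀ isCost 0<ε δ 0<δ
        in K , λ n K≤n →
             let d , q , d≤q , q≤ = short n K≤n
             in infimum≤ (proj₂ (R̄ n)) (domain-nonempty n) d λ y _ →
                  ≤-trans (E-const-≤ (trees d) (All.map (λ t≤q → fromℕ-mono (t≤q y)) d≤q)) q≤

    R-limit : 0# < ε → ∃[ R ] ((∀ n → IsR ε (OR n ∘ f) (R n)) × ((λ n → fromℕ (R n) / n) ⟶ c))
    R-limit 0<ε = (λ n → proj₁ (R n)) , (λ n → proj₂ (R n)) , squeeze lower upper
      where
      R : ∀ n → ∃[ k ] IsR ε (OR n ∘ f) k
      R n = IsR-exists 0≤ε (OR n ∘ f) (domain-nonempty n)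
      lower : ∀ n → fromℕ n * c ≤ fromℕ (proj₁ (R n))
      lower n = let A , A∈𝔄 , isMax = proj₁ (proj₂ (R n))
                in lower-bound n f fx₀ isCost A A∈𝔄 (maxCost⇒bounded A isMax)
      upper : ∀ δ → 0# < δ → ∃[ K ] (∀ n → K ℕ.≤ n → fromℕ (proj₁ (R n)) ≤ fromℕ n * (c + δ))
      upper δ 0<δ =
        let K , short = positive-error-upper fx₀ isCost 0<ε δ 0<δ
        in K , λ n K≤n →
             let d , q , d≤q , q≤ = short n K≤n
             in ≤-trans (fromℕ-mono (IsR-≤ (proj₂ (R n)) (domain-nonempty n) d q d≤q)) q≤

theorem2 : ExcludedMiddle 0ℓ →
    (ℝ : CompleteOrderedField) →
    let open QueryComplexity ℝ in
    (m : ℕ) → 1 ℕ.≤ m →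
    (f : PartialFunction m) → (∃[ x ] f x ≡ just false) →
    (∀ ε → 0# ≤ ε → ε ≤ 1# →
    Σ[ c ∈ Carrier ] Σ[ R̄ ∈ (ℕ → Carrier) ] (IsSingleCopyCost ε f c ×
    (∀ n → IsR̄ ε (OR n ∘ f) (R̄ n)) ×
    ((λ n → R̄ n / n) ⟶ c))) ×
    (∀ ε → 0# < ε → ε ≤ 1# →
    Σ[ c ∈ Carrier ] Σ[ R ∈ (ℕ → ℕ) ] (IsSingleCopyCost ε f c ×
    (∀ n → IsR ε (OR n ∘ f) (R n)) ×
    ((λ n → fromℕ (R n) / n) ⟶ c)))
theorem2 em ℝ m 1≤m f (x₀ , fx₀) =
  (λ ε 0≤ε _ →
    let c , isCost = infimum-exists 0≤ε f (x₀ , fx₀)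
        R̄ , isR̄ , limit = R̄-limit f fx₀ 0≤ε isCost
    in c , R̄ , isCost , isR̄ , limit) ,
  (λ ε 0<ε _ →
    let c , isCost = infimum-exists (proj₁ 0<ε) f (x₀ , fx₀)
        R , isR , limit = R-limit f fx₀ (proj₁ 0<ε) isCost 0<ε
    in c , R , isCost , isR , limit)
  where
  open Algorithms em ℝ using (infimum-exists)
  open Limits em ℝ
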